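{- Let $X=\mathcal{X}_e(m,n;r,t)$, where $m,n\ge 4$ are even integers and $r\in\mathbb{Z}_n^*$, $t\in\mathbb{Z}_n$ are such that $r^m=1$, $t(r-1)=0$ and $1+r+\cdots+r^{m-1}+2t=0$. Suppose $X$ is half-arc-transitive. Then $X\cong\mathcal{X}_e(m',n';r',t')$ (where $m',n'\geq 4$ are even and $r'\in\mathbb{Z}_{n'}^*$, $t'\in\mathbb{Z}_{n'}$ satisfy the analogous conditions) if and only if $m'=m$, $n'=n$ and one of the following holds: (i) $r'=r$ and $t'=t$; (ii) $r'=-r$ and $t'=t+r+r^3+\cdots+r^{m-1}$; (iii) $r'=r^{ -1}$ and $t'=t$; (iv) $r'=-r^{ -1}$ and $t'=t+r+r^3+\cdots+r^{m-1}$.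
   Context: A graph is half-arc-transitive if its automorphism group acts transitively on vertices and on edges but not on arcs (ordered pairs of adjacent vertices). $\mathbb{Z}_n$ is the ring of residue classes modulo $n$, and $\mathbb{Z}_n^*$ its set of invertible elements. For even integers $m,n\ge 4$ and $r\in\mathbb{Z}_n^*$, $t\in\mathbb{Z}_n$ satisfying $r^m=1$, $t(r-1)=0$ and $1+r+\cdots+r^{m-1}+2t=0$ in $\mathbb{Z}_n$, the graph $\mathcal{X}_e(m,n;r,t)$ has vertex set $\{u_i^j : i\in\mathbb{Z}_m, j\in\mathbb{Z}_n\}$ and edges given by: $u_i^j\sim u_{i+1}^j,\ u_{i+1}^{j+r^i}$ for $i\in\mathbb{Z}_m\setminus\{m-1\}$, $j\in\mathbb{Z}_n$; and $u_{m-1}^j\sim u_0^{j+t},\ u_0^{j+r^{m-1}+t}$ for $j\in\mathbb{Z}_n$. -}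

module Defs where

open import Algebra.Bundles using (CommutativeRing; Semiring)
open import Algebra.Definitions using (Invertible)
open import Algebra.Structures using (IsCommutativeRing)
import Algebra.Definitions.RawSemiring as RawSemiringDefinitions
open import Data.Fin.Base using (Fin; toℕ)
open import Data.Fin.Properties using (toℕ-injective; toℕ-fromℕ<; toℕ<n)
open import Data.Nat.Base as ℕ using (ℕ; NonZero; _∸_; _≤_; z≤n; s≤s)
open import Data.Nat.DivMod using (_%_; _/_; _mod_; m%n<n; m<n⇒m%n≡m; n%n≡0; %-distribˡ-+; %-distribˡ-*)
open import Data.Nat.Divisibility using (_∣_)
import Data.Nat.Properties as ℕₚ
open import Data.Product.Base using (Σ; _×_; _,_; proj₁; proj₂)
open import Data.Sum.Base using (_⊎_)
open import Function.Bundles using (_↔_; _⇔_; Inverse)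
open import Relation.Binary.Construct.Closure.Symmetric using (SymClosure; fwd; bwd; symmetric)
open import Relation.Binary.Core using (Rel)
open import Relation.Binary.Definitions using (Irreflexive; Symmetric)
open import Relation.Binary.PropositionalEquality using (_≡_; refl; sym; trans; cong; cong₂; isEquivalence)
open import Relation.Nullary using (¬_)
open import Level using (0ℓ)

------------------------------------------------------------------------
-- Residue classes modulo n

-- A class is represented by its least non-negative member, so that
-- equality in ℤₙ is propositional equality.

ℤ/_ : ℕ → Set
ℤ/ n = Fin n

module _ {n : ℕ} .{{_ : NonZero n}} where

  infixl 7 _*_
  infixl 6 _+_
  infix  8 -_

  _+_ _*_ : ℤ/ n → ℤ/ n → ℤ/ n
  a + b = (toℕ a ℕ.+ toℕ b) mod n
  a * b = (toℕ a ℕ.* toℕ b) mod n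

  -_ : ℤ/ n → ℤ/ n
  - a = (n ∸ toℕ a) mod n

  0# 1# : ℤ/ n
  0# = 0 mod n
  1# = 1 mod n

  private

    [_] : ℕ → ℤ/ n
    [ x ] = x mod n

    toℕ-mod : ∀ x → toℕ [ x ] ≡ x % n
    toℕ-mod x = toℕ-fromℕ< (m%n<n x n)

    mod-cong : ∀ {x y} → x % n ≡ y % n → [ x ] ≡ [ y ]
    mod-cong {x} {y} eq = toℕ-injective (trans (toℕ-mod x) (trans eq (sym (toℕ-mod y))))

    mod-toℕ : ∀ (a : ℤ/ n) → [ toℕ a ] ≡ a
    mod-toℕ a = toℕ-injective (trans (toℕ-mod (toℕ a)) (m<n⇒m%n≡m (toℕ<n a)))

    +-hom : ∀ x y → [ x ] + [ y ] ≡ [ x ℕ.+ y ]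
    +-hom x y = mod-cong (trans
      (cong₂ (λ p q → (p ℕ.+ q) % n) (toℕ-mod x) (toℕ-mod y))
      (sym (%-distribˡ-+ x y n)))

    *-hom : ∀ x y → [ x ] * [ y ] ≡ [ x ℕ.* y ]
    *-hom x y = mod-cong (trans
      (cong₂ (λ p q → (p ℕ.* q) % n) (toℕ-mod x) (toℕ-mod y))
      (sym (%-distribˡ-* x y n)))

    +-homˡ : ∀ x b → [ x ] + b ≡ [ x ℕ.+ toℕ b ]
    +-homˡ x b = trans (cong ([ x ] +_) (sym (mod-toℕ b))) (+-hom x (toℕ b))

    +-homʳ : ∀ a y → a + [ y ] ≡ [ toℕ a ℕ.+ y ]
    +-homʳ a y = trans (cong (_+ [ y ]) (sym (mod-toℕ a))) (+-hom (toℕ a) y)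

    *-homˡ : ∀ x b → [ x ] * b ≡ [ x ℕ.* toℕ b ]
    *-homˡ x b = trans (cong ([ x ] *_) (sym (mod-toℕ b))) (*-hom x (toℕ b))

    *-homʳ : ∀ a y → a * [ y ] ≡ [ toℕ a ℕ.* y ]
    *-homʳ a y = trans (cong (_* [ y ]) (sym (mod-toℕ a))) (*-hom (toℕ a) y)

    +-comm : ∀ a b → a + b ≡ b + a
    +-comm a b = cong [_] (ℕₚ.+-comm (toℕ a) (toℕ b))

    *-comm : ∀ a b → a * b ≡ b * a
    *-comm a b = cong [_] (ℕₚ.*-comm (toℕ a) (toℕ b))

    +-assoc : ∀ a b c → (a + b) + c ≡ a + (b + c)
    +-assoc a b c = trans (+-homˡ _ c) (trans
      (cong [_] (ℕₚ.+-assoc (toℕ a) (toℕ b) (toℕ c)))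
      (sym (+-homʳ a _)))

    *-assoc : ∀ a b c → (a * b) * c ≡ a * (b * c)
    *-assoc a b c = trans (*-homˡ _ c) (trans
      (cong [_] (ℕₚ.*-assoc (toℕ a) (toℕ b) (toℕ c)))
      (sym (*-homʳ a _)))

    +-identityˡ : ∀ a → 0# + a ≡ a
    +-identityˡ a = trans (+-homˡ 0 a) (mod-toℕ a)

    *-identityˡ : ∀ a → 1# * a ≡ a
    *-identityˡ a = trans (*-homˡ 1 a) (trans (cong [_] (ℕₚ.*-identityˡ (toℕ a))) (mod-toℕ a))

    +-inverseˡ : ∀ a → - a + a ≡ 0#
    +-inverseˡ a = trans (+-homˡ _ a) (mod-cong (trans
      (cong (_% n) (ℕₚ.m∸n+n≡m (ℕₚ.<⇒≤ (toℕ<n a))))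
      (trans (n%n≡0 n) (sym (m<n⇒m%n≡m (ℕ.>-nonZero⁻¹ n))))))

    distribˡ : ∀ a b c → a * (b + c) ≡ a * b + a * c
    distribˡ a b c = trans (*-homʳ a _) (trans
      (cong [_] (ℕₚ.*-distribˡ-+ (toℕ a) (toℕ b) (toℕ c)))
      (sym (+-hom _ _)))

    comm∧idˡ⇒idʳ : ∀ (_∙_ : ℤ/ n → ℤ/ n → ℤ/ n) {e} →
                   (∀ a b → a ∙ b ≡ b ∙ a) → (∀ a → e ∙ a ≡ a) → ∀ a → a ∙ e ≡ a
    comm∧idˡ⇒idʳ _ comm idˡ a = trans (comm a _) (idˡ a)

  +-*-isCommutativeRing : IsCommutativeRing _≡_ _+_ _*_ -_ 0# 1#
  +-*-isCommutativeRing = record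
    { isRing = record
      { +-isAbelianGroup = record
        { isGroup = record
          { isMonoid = record
            { isSemigroup = record
              { isMagma = record { isEquivalence = isEquivalence ; ∙-cong = cong₂ _+_ }
              ; assoc   = +-assoc
              }
            ; identity = +-identityˡ , comm∧idˡ⇒idʳ _+_ +-comm +-identityˡ
            }
          ; inverse = +-inverseˡ , λ a → trans (+-comm a (- a)) (+-inverseˡ a)
          ; ⁻¹-cong = cong -_
          }
        ; comm = +-comm
        }
      ; *-cong     = cong₂ _*_
      ; *-assoc    = *-assoc
      ; *-identity = *-identityˡ , comm∧idˡ⇒idʳ _*_ *-comm *-identityˡ
      ; distrib    = distribˡ , λ a b c → trans (*-comm (b + c) a) (trans (distribˡ a b c)
                       (cong₂ _+_ (*-comm a b) (*-comm a c)))
      }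
    ; *-comm = *-comm
    }

ℤ/-commutativeRing : (n : ℕ) .{{_ : NonZero n}} → CommutativeRing 0ℓ 0ℓ
ℤ/-commutativeRing n = record { isCommutativeRing = +-*-isCommutativeRing {n} }

module _ {n : ℕ} .{{_ : NonZero n}} where

  open RawSemiringDefinitions (Semiring.rawSemiring (CommutativeRing.semiring (ℤ/-commutativeRing n))) public
    using (_^_; sum)

  Unit : ℤ/ n → Set
  Unit = Invertible _≡_ 1# _*_

  -- 1 + r + ⋯ + r^(m-1)
  powerSum : ℕ → ℤ/ n → ℤ/ n
  powerSum m r = sum {m} λ i → r ^ toℕ i

  -- r + r³ + ⋯ + r^(m-1), for m even
  oddPowerSum : ℕ → ℤ/ n → ℤ/ n
  oddPowerSum m r = sum {m / 2} λ i → r ^ (1 ℕ.+ 2 ℕ.* toℕ i)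

------------------------------------------------------------------------
-- Simple graphs

record Graph : Set₁ where
  infix 4 _~_
  field
    Vertex   : Set
    _~_      : Rel Vertex 0ℓ
    ~-sym    : Symmetric _~_
    ~-irrefl : Irreflexive _≡_ _~_

infix 4 _≅_

record _≅_ (X Y : Graph) : Set where
  private
    module X = Graph X
    module Y = Graph Y
  field
    bijection : X.Vertex ↔ Y.Vertex
  open Inverse bijection public using (to; from)
  field
    adjacency : ∀ u v → u X.~ v ⇔ to u Y.~ to v

module _ (X : Graph) where
  open Graph X
  open _≅_

  Automorphism : Set
  Automorphism = X ≅ X

  VertexTransitive : Set
  VertexTransitive = ∀ u v → Σ Automorphism λ φ → to φ u ≡ v

  -- An edge is an unordered pair of adjacent vertices.
  EdgeTransitive : Set
  EdgeTransitive = ∀ {u v x y} → u ~ v → x ~ y →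
    Σ Automorphism λ φ → (to φ u ≡ x × to φ v ≡ y) ⊎ (to φ u ≡ y × to φ v ≡ x)

  ArcTransitive : Set
  ArcTransitive = ∀ {u v x y} → u ~ v → x ~ y →
    Σ Automorphism λ φ → to φ u ≡ x × to φ v ≡ y

  HalfArcTransitive : Set
  HalfArcTransitive = VertexTransitive × EdgeTransitive × ¬ ArcTransitive

------------------------------------------------------------------------
-- The graphs 𝒳ₑ(m,n;r,t)

record Admissible (m n : ℕ) .{{_ : NonZero n}} (r t : ℤ/ n) : Set where
  field
    m-even   : 2 ∣ m
    n-even   : 2 ∣ n
    4≤m      : 4 ≤ m
    4≤n      : 4 ≤ n
    r-unit   : Unit r
    r^m≡1    : r ^ m ≡ 1#
    t[r-1]≡0 : t * (r + - 1#) ≡ 0#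
    Σr+2t≡0  : powerSum m r + (t + t) ≡ 0#

  r⁻¹ : ℤ/ n
  r⁻¹ = proj₁ r-unit

-- The pair (i , j) is the vertex uᵢʲ. A step leads from layer i to layer
-- i + 1, where the passage from layer m - 1 back to layer 0 has the extra
-- shift t.

data Step {m n : ℕ} .{{_ : NonZero n}} (r t : ℤ/ n) : Rel (Fin m × ℤ/ n) 0ℓ where
  next : ∀ {i i′ j j′} → toℕ i′ ≡ ℕ.suc (toℕ i) →
         j′ ≡ j ⊎ j′ ≡ j + r ^ toℕ i →
         Step r t (i , j) (i′ , j′)
  wrap : ∀ {i i′ j j′} → ℕ.suc (toℕ i) ≡ m → toℕ i′ ≡ 0 →
         j′ ≡ j + t ⊎ j′ ≡ j + r ^ (m ∸ 1) + t →
         Step r t (i , j) (i′ , j′)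

Step-irrefl : ∀ {m n} .{{_ : NonZero n}} {r t : ℤ/ n} → 4 ≤ m → Irreflexive _≡_ (Step {m} r t)
Step-irrefl _   refl (next eq _)      = ℕₚ.1+n≢n (sym eq)
Step-irrefl 4≤m refl (wrap last i≡0 _) =
  ℕₚ.<⇒≢ (ℕₚ.≤-trans (s≤s (s≤s z≤n)) 4≤m) (trans (cong ℕ.suc (sym i≡0)) last)

𝒳ₑ : (m n : ℕ) .{{_ : NonZero n}} (r t : ℤ/ n) → Admissible m n r t → Graph
𝒳ₑ m n r t a = record
  { Vertex   = Fin m × ℤ/ n
  ; _~_      = SymClosure (Step r t)
  ; ~-sym    = symmetric (Step r t)
  ; ~-irrefl = λ { eq (fwd s) → Step-irrefl (Admissible.4≤m a) eq s
                 ; eq (bwd s) → Step-irrefl (Admissible.4≤m a) (sym eq) s }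
  }

{-# OPTIONS --safe #-}

-- Coordinates π i j on a digraph record how it is swept out by alternating
-- cycles through consecutive layers. If two coordinate systems agree on one arc,
-- they agree on the alternating cycle through it, hence on two whole layers; the
-- common out-neighbours of the vertices of a layer then force r′ = ±r and spread
-- the agreement, which determines t. Every arc is the base of a coordinate
-- system, so the natural orientation is arc-transitive. Half-arc-transitivity
-- therefore makes every isomorphism preserve or reverse the orientation, and the
-- reversed digraph has coordinates with parameters (r⁻¹ , t).

module Submission where

open import Defs
open import Algebra.Bundles using (CommutativeRing)
open import Data.Fin.Base using (Fin; toℕ; fromℕ<; cast; opposite)
open import Data.Fin.Permutation using (reverse)
open import Data.Fin.Properties using (toℕ-injective; toℕ-fromℕ<; toℕ-fromℕ; toℕ-inject₁; toℕ<n; opposite-prop; cast-is-id)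
open import Data.Nat.Base as ℕ using (ℕ; zero; suc; pred; NonZero; _≤_; _∸_)
open import Data.Nat.DivMod
open import Data.Nat.Divisibility using (_∣_; m%n≡0⇒n∣m; ∣m+n∣m⇒∣n; ∣-antisym; n∣m*n; ∣⇒≤; m∣m*n)
import Data.Nat.Properties as ℕₚ
open import Data.Nat.Solver using (module +-*-Solver)
open import Data.Product.Base using (Σ; ∃; ∃₂; _×_; _,_; proj₁; proj₂)
open import Data.Sum.Base as Sum using (_⊎_; inj₁; inj₂)
open import Function.Base using (flip; id)
open import Function.Bundles using (_⇔_; mk⇔; mk↔ₛ′; Equivalence; Inverse)
open import Function.Construct.Composition using (_⇔-∘_)
open import Function.Properties.Inverse using (↔-sym; ↔-trans)
open import Level using (0ℓ)
open import Relation.Binary.Construct.Closure.Symmetric using (SymClosure; fwd; bwd; gmap)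
open import Relation.Binary.Core using (Rel)
open import Relation.Binary.PropositionalEquality
open import Relation.Nullary using (¬_; yes; no; contradiction)

-- Arithmetic in ℤ/ n

-- The two relations on the parameters make coordinates movable: `t * (r + - 1#) ≡ 0#` allows any
-- vertex to become the origin, and `powerSum m r + (t + t) ≡ 0#` provides a reflection that fixes
-- the origin and exchanges its two out-neighbours. The bound on `n` keeps `r ^ i` and `- (r ^ i)`
-- apart, without which neighbourhoods could not pin down superscripts. The sign of `r` is a genuine
-- ambiguity, because the out-neighbours of a vertex form an unordered pair: exchanging their roles
-- in the odd layers replaces `r` by `- r`. The displacement that this collects over one turn is the
-- sum of the odd powers, hence the second value of `t′`. The four cases of the theorem are the two
-- independent choices of sign and orientation. Coordinates live on an arbitrary relation so that
-- one comparison serves the digraph, its reverse, and systems pulled back along an isomorphism.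

parity : ∀ i → ∃ λ k → i ≡ 2 ℕ.* k ⊎ i ≡ 1 ℕ.+ 2 ℕ.* k
parity zero = 0 , inj₁ refl
parity (suc i) with parity i
... | k , inj₁ eq = k , inj₂ (cong suc eq)
... | k , inj₂ eq = suc k , inj₁ (trans (cong suc eq) (sym (ℕₚ.*-suc 2 k)))

2k/2 : ∀ k → 2 ℕ.* k / 2 ≡ k
2k/2 k = trans (cong (_/ 2) (ℕₚ.*-comm 2 k)) (m*n/n≡m k 2)

[1+2k]/2 : ∀ k → (1 ℕ.+ 2 ℕ.* k) / 2 ≡ k
[1+2k]/2 k = trans (+-distrib-/-∣ʳ 1 {d = 2} (m∣m*n {2} k)) (2k/2 k)

module _ {n : ℕ} .{{_ : NonZero n}} where

  open CommutativeRing (ℤ/-commutativeRing n) public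
    using (+-assoc; +-comm; +-identityˡ; +-identityʳ; -‿inverseˡ; -‿inverseʳ; +-commutativeMonoid;
           *-assoc; *-comm; *-identityˡ; *-identityʳ; distribˡ; distribʳ; zeroˡ; zeroʳ; semiring; ring; commutativeSemiring)
  open import Algebra.Properties.Ring ring public
    using (+-cancelˡ; +-cancelʳ; +-inverseˡ-unique; -1*x≈-x; -‿distribˡ-*; -‿involutive)
  open import Algebra.Properties.CommutativeSemigroup
    (CommutativeRing.+-commutativeSemigroup (ℤ/-commutativeRing n)) public using (interchange; xy∙z≈xz∙y)
  open import Algebra.Properties.Semiring.Mult semiring public
    using (×-homo-+) renaming (_×_ to infixr 8 _·_)
  open import Algebra.Properties.CommutativeMonoid.Mult +-commutativeMonoid public
    using () renaming (×-distrib-+ to ·-distrib-+)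
  open import Algebra.Properties.Semiring.Exp semiring public
    using (^-homo-*; ^-assocʳ)
  open import Algebra.Properties.CommutativeSemiring.Exp commutativeSemiring public
    using (^-distrib-*)
  open import Algebra.Properties.CommutativeMonoid.Sum +-commutativeMonoid public
    using (sum-init-last; sum-cong-≗; sum-permute)

  open ≡-Reasoning

  ·1≡mod : ∀ x → x · 1# {n} ≡ x mod n
  ·1≡mod zero    = refl
  ·1≡mod (suc x) = toℕ-injective (begin
    toℕ (1# + x · 1#)                     ≡⟨ cong (λ y → toℕ (1# {n} + y)) (·1≡mod x) ⟩
    toℕ (1# {n} + (x mod n))              ≡⟨ toℕ-fromℕ< _ ⟩
    (toℕ (1 mod n) ℕ.+ toℕ (x mod n)) % n ≡⟨ cong₂ (λ a b → (a ℕ.+ b) % n) (toℕ-fromℕ< (m%n<n 1 n)) (toℕ-fromℕ< (m%n<n x n)) ⟩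
    (1 % n ℕ.+ x % n) % n                 ≡⟨ %-distribˡ-+ 1 x n ⟨
    suc x % n                             ≡⟨ toℕ-fromℕ< _ ⟨
    toℕ (suc x mod n)                     ∎)

  toℕ-·1 : ∀ x → toℕ (x · 1# {n}) ≡ x % n
  toℕ-·1 x = trans (cong toℕ (·1≡mod x)) (toℕ-fromℕ< _)

  ·1≡0⇒∣ : ∀ x → x · 1# {n} ≡ 0# → n ∣ x
  ·1≡0⇒∣ x eq = m%n≡0⇒n∣m x n (begin
    x % n            ≡⟨ toℕ-·1 x ⟨
    toℕ (x · 1# {n}) ≡⟨ cong toℕ eq ⟩
    toℕ (0# {n})     ≡⟨ toℕ-fromℕ< _ ⟩
    0 % n            ≡⟨ m*n%n≡0 0 n ⟩
    0                ∎)

  n·1≡0 : n · 1# {n} ≡ 0#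
  n·1≡0 = toℕ-injective (begin
    toℕ (n · 1# {n}) ≡⟨ toℕ-·1 n ⟩
    n % n            ≡⟨ n%n≡0 n ⟩
    0                ≡⟨ m*n%n≡0 0 n ⟨
    0 % n            ≡⟨ toℕ-fromℕ< _ ⟨
    toℕ (0# {n})     ∎)

  toℕ·1 : ∀ (j : ℤ/ n) → toℕ j · 1# ≡ j
  toℕ·1 j = toℕ-injective (trans (toℕ-·1 (toℕ j)) (m<n⇒m%n≡m (toℕ<n j)))

  x-y+y : ∀ (x y : ℤ/ n) → (x + - y) + y ≡ x
  x-y+y x y = trans (+-assoc x (- y) y) (trans (cong (x +_) (-‿inverseˡ y)) (+-identityʳ x))

  +-absorb : ∀ (x : ℤ/ n) {y} → y ≡ 0# → x + y ≡ x
  +-absorb x eq = trans (cong (x +_) eq) (+-identityʳ x)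

  +-absorb⁻¹ : ∀ {x y : ℤ/ n} → x ≡ x + y → y ≡ 0#
  +-absorb⁻¹ {x} {y} eq = +-cancelˡ x y 0# (trans (sym eq) (sym (+-identityʳ x)))

  -- For a power of `r` this says that `r ^ i` differs from its negative, so that the two outcomes
  -- of comparing consecutive layers exclude each other.
  Double≢0 : ℤ/ n → Set
  Double≢0 x = x + x ≢ 0#

  double≢0⇒≢0 : ∀ {x : ℤ/ n} → Double≢0 x → x ≢ 0#
  double≢0⇒≢0 2x≢0 refl = 2x≢0 (+-identityˡ 0#)

  unit⇒double≢0 : 4 ≤ n → ∀ {x : ℤ/ n} → Unit x → Double≢0 x
  unit⇒double≢0 4≤n {x} (y , yx≡1 , _) 2x≡0 =
    ℕₚ.<⇒≱ (ℕₚ.≤-trans (ℕₚ.n≤1+n 3) 4≤n) (∣⇒≤ (·1≡0⇒∣ 2 (begin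
      1# + (1# + 0#)   ≡⟨ cong (1# {n} +_) (+-identityʳ 1#) ⟩
      1# {n} + 1#      ≡⟨ cong₂ _+_ yx≡1 yx≡1 ⟨
      y * x + y * x    ≡⟨ distribˡ y x x ⟨
      y * (x + x)      ≡⟨ cong (y *_) 2x≡0 ⟩
      y * 0#           ≡⟨ zeroʳ y ⟩
      0#               ∎)))

  1^ : ∀ k → 1# {n} ^ k ≡ 1#
  1^ zero    = refl
  1^ (suc k) = trans (*-identityˡ (1# ^ k)) (1^ k)

  unit-^ : ∀ {x : ℤ/ n} → Unit x → ∀ k → Unit (x ^ k)
  unit-^ {x} (y , yx≡1 , xy≡1) k = y ^ k , inv yx≡1 , inv xy≡1
    where
    inv : ∀ {x y : ℤ/ n} → x * y ≡ 1# → x ^ k * y ^ k ≡ 1#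
    inv {x} {y} eq = trans (sym (^-distrib-* x y k)) (trans (cong (_^ k) eq) (1^ k))

  unit-cancelˡ : ∀ {a : ℤ/ n} → Unit a → ∀ {x y} → a * x ≡ a * y → x ≡ y
  unit-cancelˡ {a} (b , ba≡1 , _) {x} {y} eq = trans (sym (undo x)) (trans (cong (b *_) eq) (undo y))
    where
    undo : ∀ z → b * (a * z) ≡ z
    undo z = trans (sym (*-assoc b a z)) (trans (cong (_* z) ba≡1) (*-identityˡ z))

  -1-unit : Unit (- 1# {n})
  -1-unit = - 1# , eq , eq
    where
    eq : - 1# * - 1# {n} ≡ 1#
    eq = trans (-1*x≈-x (- 1#)) (-‿involutive 1#)

  -- Both `powerSum` and `oddPowerSum` unfold to such initial sums, so they share one recursion and
  -- one periodicity argument.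
  Σ< : (ℕ → ℤ/ n) → ℕ → ℤ/ n
  Σ< f k = sum {n} {k} λ i → f (toℕ i)

  Σ<-suc : ∀ f k → Σ< f (suc k) ≡ Σ< f k + f k
  Σ<-suc f k = trans (sum-init-last {k} λ i → f (toℕ i))
    (cong₂ _+_ (sum-cong-≗ {k} λ i → cong f (toℕ-inject₁ i)) (cong f (toℕ-fromℕ k)))

  Σ<-period : ∀ f h → (∀ k → f (h ℕ.+ k) ≡ f k) → ∀ k → Σ< f (h ℕ.+ k) ≡ Σ< f h + Σ< f k
  Σ<-period f h per zero = trans (cong (Σ< f) (ℕₚ.+-identityʳ h)) (sym (+-identityʳ _))
  Σ<-period f h per (suc k) = begin
    Σ< f (h ℕ.+ suc k)             ≡⟨ cong (Σ< f) (ℕₚ.+-suc h k) ⟩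
    Σ< f (suc (h ℕ.+ k))           ≡⟨ Σ<-suc f (h ℕ.+ k) ⟩
    Σ< f (h ℕ.+ k) + f (h ℕ.+ k)   ≡⟨ cong₂ _+_ (Σ<-period f h per k) (per k) ⟩
    (Σ< f h + Σ< f k) + f k        ≡⟨ +-assoc _ _ _ ⟩
    Σ< f h + (Σ< f k + f k)        ≡⟨ cong (Σ< f h +_) (Σ<-suc f k) ⟨
    Σ< f h + Σ< f (suc k)          ∎

  oddPower : ℤ/ n → ℕ → ℤ/ n
  oddPower r k = r ^ (1 ℕ.+ 2 ℕ.* k)

  module _ {r : ℤ/ n} {m : ℕ} (r^m≡1 : r ^ m ≡ 1#) where

    ^-period : ∀ k → r ^ (m ℕ.+ k) ≡ r ^ k
    ^-period k = trans (^-homo-* r m k) (trans (cong (_* r ^ k) r^m≡1) (*-identityˡ (r ^ k)))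

    powerSum-period : ∀ k → powerSum (m ℕ.+ k) r ≡ powerSum m r + powerSum k r
    powerSum-period = Σ<-period (r ^_) m ^-period

    oddPowerSum-period : 2 ∣ m → ∀ k → oddPowerSum (m ℕ.+ k) r ≡ oddPowerSum m r + oddPowerSum k r
    oddPowerSum-period 2∣m k = trans
      (cong (Σ< (oddPower r)) (+-distrib-/-∣ˡ k 2∣m))
      (Σ<-period (oddPower r) (m / 2) oddPower-period (k / 2))
      where
      oddPower-period : ∀ k → oddPower r (m / 2 ℕ.+ k) ≡ oddPower r k
      oddPower-period k = trans (cong (r ^_) (begin
        1 ℕ.+ 2 ℕ.* (m / 2 ℕ.+ k)            ≡⟨ cong suc (ℕₚ.*-distribˡ-+ 2 (m / 2) k) ⟩
        1 ℕ.+ (2 ℕ.* (m / 2) ℕ.+ 2 ℕ.* k)    ≡⟨ cong (λ l → 1 ℕ.+ (l ℕ.+ 2 ℕ.* k)) (m*[n/m]≡n 2∣m) ⟩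
        1 ℕ.+ (m ℕ.+ 2 ℕ.* k)                ≡⟨ ℕₚ.+-suc m (2 ℕ.* k) ⟨
        m ℕ.+ (1 ℕ.+ 2 ℕ.* k)                ∎)) (^-period (1 ℕ.+ 2 ℕ.* k))

    inverse-^ : ∀ {q} → q * r ≡ 1# → ∀ {k l} → k ℕ.+ l ≡ m → q ^ k ≡ r ^ l
    inverse-^ {q} qr≡1 {k} {l} eq = begin
      q ^ k                  ≡⟨ *-identityʳ (q ^ k) ⟨
      q ^ k * 1#             ≡⟨ cong (q ^ k *_) (trans (cong (r ^_) eq) r^m≡1) ⟨
      q ^ k * r ^ (k ℕ.+ l)  ≡⟨ cong (q ^ k *_) (^-homo-* r k l) ⟩
      q ^ k * (r ^ k * r ^ l) ≡⟨ *-assoc (q ^ k) (r ^ k) (r ^ l) ⟨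
      (q ^ k * r ^ k) * r ^ l ≡⟨ cong (_* r ^ l) (trans (sym (^-distrib-* q r k)) (trans (cong (_^ k) qr≡1) (1^ k))) ⟩
      1# * r ^ l             ≡⟨ *-identityˡ (r ^ l) ⟩
      r ^ l                  ∎

    -- For even `m` the map sending `k` to `m - k` permutes the odd exponents below `m`, and `q ^ k`
    -- equals `r ^ (m - k)`. Hence the twisted shift is the same for both orientations.
    oddPowerSum-inverse : 2 ∣ m → ∀ {q} → q * r ≡ 1# → oddPowerSum m q ≡ oddPowerSum m r
    oddPowerSum-inverse 2∣m {q} qr≡1 = trans
      (sum-permute (λ i → q ^ (1 ℕ.+ 2 ℕ.* toℕ i)) (reverse {m / 2}))
      (sum-cong-≗ {m / 2} λ i → inverse-^ {q} qr≡1 {1 ℕ.+ 2 ℕ.* toℕ (opposite i)} {1 ℕ.+ 2 ℕ.* toℕ i} (complement i))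
      where
      complement : ∀ (i : Fin (m / 2)) → (1 ℕ.+ 2 ℕ.* toℕ (opposite i)) ℕ.+ (1 ℕ.+ 2 ℕ.* toℕ i) ≡ m
      complement i = begin
        (1 ℕ.+ 2 ℕ.* toℕ (opposite i)) ℕ.+ (1 ℕ.+ 2 ℕ.* toℕ i)
          ≡⟨ solve 2 (λ x y → (con 1 :+ con 2 :* x) :+ (con 1 :+ con 2 :* y) := con 2 :* (x :+ (con 1 :+ y))) refl
               (toℕ (opposite i)) (toℕ i) ⟩
        2 ℕ.* (toℕ (opposite i) ℕ.+ suc (toℕ i))
          ≡⟨ cong (λ k → 2 ℕ.* (k ℕ.+ suc (toℕ i))) (opposite-prop i) ⟩
        2 ℕ.* ((m / 2 ∸ suc (toℕ i)) ℕ.+ suc (toℕ i))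
          ≡⟨ cong (2 ℕ.*_) (ℕₚ.m∸n+n≡m (toℕ<n i)) ⟩
        2 ℕ.* (m / 2)
          ≡⟨ m*[n/m]≡n 2∣m ⟩
        m ∎
        where open +-*-Solver

  module _ (r : ℤ/ n) where

    -^-even : ∀ k → (- r) ^ (2 ℕ.* k) ≡ r ^ (2 ℕ.* k)
    -^-even k = begin
      (- r) ^ (2 ℕ.* k)  ≡⟨ ^-assocʳ (- r) 2 k ⟨
      ((- r) ^ 2) ^ k    ≡⟨ cong (_^ k) square ⟩
      (r ^ 2) ^ k        ≡⟨ ^-assocʳ r 2 k ⟩
      r ^ (2 ℕ.* k)      ∎
      where
      square : (- r) ^ 2 ≡ r ^ 2
      square = begin
        - r * (- r * 1#)   ≡⟨ -‿distribˡ-* r (- r * 1#) ⟨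
        - (r * (- r * 1#)) ≡⟨ cong (λ x → - (r * x)) (-‿distribˡ-* r 1#) ⟨
        - (r * - (r * 1#)) ≡⟨ cong -_ (*-comm r _) ⟩
        - (- (r * 1#) * r) ≡⟨ cong -_ (-‿distribˡ-* (r * 1#) r) ⟨
        - - (r * 1# * r)   ≡⟨ -‿involutive _ ⟩
        r * 1# * r         ≡⟨ *-comm _ r ⟩
        r * (r * 1#)       ∎

    -- As `i / 2` counts the odd numbers below `i`, `oddPowerSum i r` is the sum of the odd powers
    -- below `i` for odd `i` too. It gains a term exactly at those `i` where `(- r) ^ i` has the
    -- opposite sign to `r ^ i`.
    oddPowerSum-step : ∀ i →
      (oddPowerSum (suc i) r ≡ oddPowerSum i r × (- r) ^ i ≡ r ^ i) ⊎
      (oddPowerSum (suc i) r ≡ oddPowerSum i r + r ^ i × (- r) ^ i + r ^ i ≡ 0#)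
    oddPowerSum-step i with parity i
    ... | k , inj₁ refl = inj₁ (cong (Σ< (oddPower r)) (trans ([1+2k]/2 k) (sym (2k/2 k))) , -^-even k)
    ... | k , inj₂ refl = inj₂ (sum-eq , (begin
        - r * (- r) ^ (2 ℕ.* k) + r * r ^ (2 ℕ.* k) ≡⟨ cong (λ x → - r * x + r * r ^ (2 ℕ.* k)) (-^-even k) ⟩
        - r * r ^ (2 ℕ.* k) + r * r ^ (2 ℕ.* k)     ≡⟨ distribʳ _ (- r) r ⟨
        (- r + r) * r ^ (2 ℕ.* k)                   ≡⟨ cong (_* r ^ (2 ℕ.* k)) (-‿inverseˡ r) ⟩
        0# * r ^ (2 ℕ.* k)                          ≡⟨ zeroˡ _ ⟩
        0#                                          ∎))
      where
      sum-eq : Σ< (oddPower r) ((2 ℕ.+ 2 ℕ.* k) / 2) ≡ Σ< (oddPower r) ((1 ℕ.+ 2 ℕ.* k) / 2) + oddPower r k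
      sum-eq = begin
        Σ< (oddPower r) ((2 ℕ.+ 2 ℕ.* k) / 2)  ≡⟨ cong (λ l → Σ< (oddPower r) (l / 2)) (ℕₚ.*-suc 2 k) ⟨
        Σ< (oddPower r) (2 ℕ.* suc k / 2)      ≡⟨ cong (Σ< (oddPower r)) (2k/2 (suc k)) ⟩
        Σ< (oddPower r) (suc k)                ≡⟨ Σ<-suc (oddPower r) k ⟩
        Σ< (oddPower r) k + oddPower r k       ≡⟨ cong (λ l → Σ< (oddPower r) l + oddPower r k) ([1+2k]/2 k) ⟨
        Σ< (oddPower r) ((1 ℕ.+ 2 ℕ.* k) / 2) + oddPower r k ∎

-- Layered coordinates

-- π i j is the vertex uᵢʲ, with the layers indexed by ℕ instead of ℤ/ m: the
-- shift t, which in 𝒳ₑ is carried by the edges from layer m - 1 to layer 0,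
-- then appears only in the period of π.
record Coordinates {V : Set} (E : Rel V 0ℓ) (m : ℕ) {n : ℕ} .{{_ : NonZero n}} (r t : ℤ/ n) : Set where
  field
    π          : ℕ → ℤ/ n → V
    surjective : ∀ v → ∃₂ λ i j → π i j ≡ v
    injective  : ∀ i {j k} → π i j ≡ π i k → j ≡ k
    layer      : ∀ {i i′ j j′} → π i j ≡ π i′ j′ → ∃₂ λ a b → i ℕ.+ a ℕ.* m ≡ i′ ℕ.+ b ℕ.* m
    period     : ∀ i j → π (m ℕ.+ i) j ≡ π i (j + t)
    out        : ∀ i j {v} → E (π i j) v ⇔ (v ≡ π (suc i) j ⊎ v ≡ π (suc i) (j + r ^ i))

  edge₀ : ∀ i j → E (π i j) (π (suc i) j)
  edge₀ i j = Equivalence.from (out i j) (inj₁ refl)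

  edge₁ : ∀ i j → E (π i j) (π (suc i) (j + r ^ i))
  edge₁ i j = Equivalence.from (out i j) (inj₂ refl)

  open ≡-Reasoning

  period* : ∀ a i j → π (i ℕ.+ a ℕ.* m) j ≡ π i (j + a · t)
  period* zero    i j = cong₂ π (ℕₚ.+-identityʳ i) (sym (+-identityʳ j))
  period* (suc a) i j = begin
    π (i ℕ.+ (m ℕ.+ a ℕ.* m)) j  ≡⟨ cong (λ k → π k j) (solve 3 (λ i m k → i :+ (m :+ k) := m :+ (i :+ k)) refl i m (a ℕ.* m)) ⟩
    π (m ℕ.+ (i ℕ.+ a ℕ.* m)) j  ≡⟨ period (i ℕ.+ a ℕ.* m) j ⟩
    π (i ℕ.+ a ℕ.* m) (j + t)    ≡⟨ period* a i (j + t) ⟩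
    π i ((j + t) + a · t)        ≡⟨ cong (π i) (+-assoc j t (a · t)) ⟩
    π i (j + suc a · t)          ∎
    where open +-*-Solver

  unperiod* : ∀ a i j → π i j ≡ π (i ℕ.+ a ℕ.* m) (j + - (a · t))
  unperiod* a i j = trans (cong (π i) (sym (x-y+y j (a · t)))) (sym (period* a i (j + - (a · t))))

  -- The hypothesis is congruence of `i` and `k` modulo `m`, written without subtraction: layers
  -- with congruent indices are the same set of vertices.
  relayer : ∀ {i k} a b → i ℕ.+ a ℕ.* m ≡ k ℕ.+ b ℕ.* m → ∀ x → ∃ λ y → π i y ≡ π k x
  relayer {i} {k} a b eq x = x + - (b · t) + a · t , (begin
    π i (x + - (b · t) + a · t)        ≡⟨ period* a i (x + - (b · t)) ⟨
    π (i ℕ.+ a ℕ.* m) (x + - (b · t))  ≡⟨ cong (λ l → π l (x + - (b · t))) eq ⟩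
    π (k ℕ.+ b ℕ.* m) (x + - (b · t))  ≡⟨ unperiod* b k x ⟨
    π k x                              ∎)

  out-layer : ∀ {i j v} → E (π i j) v → ∃ λ k → v ≡ π (suc i) k
  out-layer {i} {j} e with Equivalence.to (out i j) e
  ... | inj₁ eq = j , eq
  ... | inj₂ eq = j + r ^ i , eq

  -- The field `out` describes arcs from their tails only. The layer of an unknown in-neighbour is
  -- determined modulo `m`, so the in-neighbour is first renamed into layer `i`.
  in⇔ : ∀ i {j k} → j + r ^ i ≡ k → ∀ {v} → E v (π (suc i) k) ⇔ (v ≡ π i k ⊎ v ≡ π i j)
  in⇔ i {j} {k} j+rⁱ≡k {v} = mk⇔ into from
    where
    sameLayer : ∀ x → E (π i x) (π (suc i) k) → π i x ≡ π i k ⊎ π i x ≡ π i j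
    sameLayer x e with Equivalence.to (out i x) e
    ... | inj₁ eq = inj₁ (cong (π i) (sym (injective (suc i) eq)))
    ... | inj₂ eq = inj₂ (cong (π i) (sym (+-cancelʳ (r ^ i) j x (trans j+rⁱ≡k (injective (suc i) eq)))))

    into : E v (π (suc i) k) → v ≡ π i k ⊎ v ≡ π i j
    into e with surjective v
    ... | l , x , refl with out-layer e
    ... | y , eq with layer eq
    ... | a , b , eq′ with relayer {i} {l} a b (ℕₚ.suc-injective eq′) x
    ... | y , y≡v = subst (λ v → v ≡ π i k ⊎ v ≡ π i j) y≡v
                      (sameLayer y (subst (λ v → E v (π (suc i) k)) (sym y≡v) e))

    from : v ≡ π i k ⊎ v ≡ π i j → E v (π (suc i) k)
    from (inj₁ refl) = edge₀ i k
    from (inj₂ refl) = subst (λ k → E (π i j) (π (suc i) k)) j+rⁱ≡k (edge₁ i j)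

  -- An arc followed by its reverse climbs two layers and returns to its start, so `m` would divide
  -- 2.
  asymmetric : 4 ≤ m → ∀ {u v} → E u v → ¬ E v u
  asymmetric 4≤m {u} e e′ with surjective u
  ... | i , j , refl with out-layer e
  ... | k , refl with out-layer e′
  ... | l , eq with layer eq
  ... | a , b , eq′ = ℕₚ.<⇒≱ (ℕₚ.≤-trans (ℕₚ.n≤1+n 3) 4≤m) (∣⇒≤ m∣2)
    where
    open +-*-Solver

    m∣2 : m ∣ 2
    m∣2 = ∣m+n∣m⇒∣n {m} {b ℕ.* m} {2} (subst (m ∣_) (ℕₚ.+-cancelˡ-≡ i _ _ (trans eq′
      (solve 2 (λ i k → con 2 :+ i :+ k := i :+ (k :+ con 2)) refl i (b ℕ.* m)))) (n∣m*n a)) (n∣m*n b)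

open Coordinates

-- Digraphs with equal parameters

module _ {n : ℕ} .{{_ : NonZero n}} {m : ℕ} {r t : ℤ/ n} where

  open ≡-Reasoning

  -- Which pairs (i , j) name the same vertex depends on m and t only.
  transfer : ∀ {V V′} {E : Rel V 0ℓ} {E′ : Rel V′ 0ℓ}
    (C : Coordinates E m r t) (C′ : Coordinates E′ m r t) →
    ∀ {i j i′ j′} → π C i j ≡ π C i′ j′ → π C′ i j ≡ π C′ i′ j′
  transfer C C′ {i} {j} {i′} {j′} eq with layer C eq
  ... | a , b , i+am≡i′+bm = begin
    π C′ i j                                   ≡⟨ unperiod* C′ a i j ⟩
    π C′ (i ℕ.+ a ℕ.* m) (j + - (a · t))       ≡⟨ cong₂ (π C′) i+am≡i′+bm same ⟩
    π C′ (i′ ℕ.+ b ℕ.* m) (j′ + - (b · t))     ≡⟨ unperiod* C′ b i′ j′ ⟨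
    π C′ i′ j′                                 ∎
    where
    same : j + - (a · t) ≡ j′ + - (b · t)
    same = injective C (i ℕ.+ a ℕ.* m) (begin
      π C (i ℕ.+ a ℕ.* m) (j + - (a · t))      ≡⟨ unperiod* C a i j ⟨
      π C i j                                  ≡⟨ eq ⟩
      π C i′ j′                                ≡⟨ unperiod* C b i′ j′ ⟩
      π C (i′ ℕ.+ b ℕ.* m) (j′ + - (b · t))    ≡⟨ cong (λ k → π C k (j′ + - (b · t))) i+am≡i′+bm ⟨
      π C (i ℕ.+ a ℕ.* m) (j′ + - (b · t))     ∎)

  relabel : ∀ {V V′} {E : Rel V 0ℓ} {E′ : Rel V′ 0ℓ} →
    Coordinates E m r t → Coordinates E′ m r t → V → V′
  relabel C C′ v with surjective C v
  ... | i , j , _ = π C′ i j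

  module _ {V V′} {E : Rel V 0ℓ} {E′ : Rel V′ 0ℓ}
    (C : Coordinates E m r t) (C′ : Coordinates E′ m r t) where

    -- `relabel` uses whichever name `surjective` picks for a vertex; `transfer` makes that choice
    -- harmless.
    relabel-π : ∀ i j → relabel C C′ (π C i j) ≡ π C′ i j
    relabel-π i j with surjective C (π C i j)
    ... | i′ , j′ , eq = transfer C C′ eq

    relabel-E : ∀ {u v} → E u v → E′ (relabel C C′ u) (relabel C C′ v)
    relabel-E {u} e with surjective C u
    ... | i , j , refl with Equivalence.to (out C i j) e
    ... | inj₁ refl = subst (E′ _) (sym (relabel-π (suc i) j)) (edge₀ C′ i j)
    ... | inj₂ refl = subst (E′ _) (sym (relabel-π (suc i) (j + r ^ i))) (edge₁ C′ i j)

  relabel-inverse : ∀ {V V′} {E : Rel V 0ℓ} {E′ : Rel V′ 0ℓ}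
    (C : Coordinates E m r t) (C′ : Coordinates E′ m r t) → ∀ v → relabel C′ C (relabel C C′ v) ≡ v
  relabel-inverse C C′ v with surjective C v
  ... | i , j , eq = trans (relabel-π C′ C i j) eq

-- Changes of coordinates

module _ {n : ℕ} .{{_ : NonZero n}} {m : ℕ} .{{_ : NonZero m}} {V : Set} {E : Rel V 0ℓ} {r t : ℤ/ n} where

  open ≡-Reasoning

  Shifts : (s : ℕ) (a r′ : ℤ/ n) (c : ℕ → ℤ/ n) → Set
  Shifts s a r′ c = ∀ i →
    (c (suc i) ≡ c i × a * r′ ^ i ≡ r ^ (i ℕ.+ s)) ⊎
    (c (suc i) ≡ c i + r ^ (i ℕ.+ s) × a * r′ ^ i + r ^ (i ℕ.+ s) ≡ 0#)

  -- uᵢʲ is renamed u_{i+s}^{aj+cᵢ}. Either cᵢ₊₁ = cᵢ and the two out-neighbours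
  -- keep their roles, or cᵢ₊₁ = cᵢ + r^(i+s) and they are interchanged.
  recoordinate : Coordinates E m r t → ∀ {r′ t′} s {a} → Unit a → (c : ℕ → ℤ/ n) →
    Shifts s a r′ c → (∀ i → c (m ℕ.+ i) + t ≡ a * t′ + c i) → Coordinates E m r′ t′
  recoordinate C {r′} {t′} s {a} a-unit@(b , _ , ab≡1) c shifts c-period = record
    { π          = π′
    ; surjective = surjective′
    ; injective  = λ i eq → unit-cancelˡ a-unit (+-cancelʳ (c i) _ _ (injective C (i ℕ.+ s) eq))
    ; layer      = layer′
    ; period     = period′
    ; out        = out′
    }
    where
    π′ : ℕ → ℤ/ n → V
    π′ i j = π C (i ℕ.+ s) (a * j + c i)

    surjective′ : ∀ v → ∃₂ λ i j → π′ i j ≡ v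
    surjective′ v with surjective C v
    -- The index must become congruent to `k` after adding `s`; `k + s * (m - 1)` does this in ℕ,
    -- since adding `s` gives `k + s * m`.
    ... | k , x , refl with relayer C {k ℕ.+ s ℕ.* pred m ℕ.+ s} {k} 0 s layers x
      where
      layers : k ℕ.+ s ℕ.* pred m ℕ.+ s ℕ.+ 0 ≡ k ℕ.+ s ℕ.* m
      layers = begin
        k ℕ.+ s ℕ.* pred m ℕ.+ s ℕ.+ 0
          ≡⟨ solve 3 (λ k s m → k :+ s :* m :+ s :+ con 0 := k :+ s :* (con 1 :+ m)) refl k s (pred m) ⟩
        k ℕ.+ s ℕ.* suc (pred m)
          ≡⟨ cong (λ l → k ℕ.+ s ℕ.* l) (ℕₚ.suc-pred m) ⟩
        k ℕ.+ s ℕ.* m ∎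
        where open +-*-Solver
    ... | y , eq = i , b * (y + - c i) , trans (cong (π C (i ℕ.+ s)) solves) eq
      where
      i = k ℕ.+ s ℕ.* pred m

      solves : a * (b * (y + - c i)) + c i ≡ y
      solves = begin
        a * (b * (y + - c i)) + c i  ≡⟨ cong (_+ c i) (*-assoc a b _) ⟨
        a * b * (y + - c i) + c i    ≡⟨ cong (λ u → u * (y + - c i) + c i) ab≡1 ⟩
        1# * (y + - c i) + c i       ≡⟨ cong (_+ c i) (*-identityˡ _) ⟩
        (y + - c i) + c i            ≡⟨ x-y+y y (c i) ⟩
        y                            ∎

    layer′ : ∀ {i i′ j j′} → π′ i j ≡ π′ i′ j′ → ∃₂ λ p q → i ℕ.+ p ℕ.* m ≡ i′ ℕ.+ q ℕ.* m
    layer′ {i} {i′} eq with layer C eq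
    ... | p , q , eq′ = p , q , ℕₚ.+-cancelʳ-≡ s _ _ (begin
      i ℕ.+ p ℕ.* m ℕ.+ s     ≡⟨ xyz i (p ℕ.* m) ⟩
      i ℕ.+ s ℕ.+ p ℕ.* m     ≡⟨ eq′ ⟩
      i′ ℕ.+ s ℕ.+ q ℕ.* m    ≡⟨ xyz i′ (q ℕ.* m) ⟨
      i′ ℕ.+ q ℕ.* m ℕ.+ s    ∎)
      where
      open +-*-Solver
      xyz : ∀ x y → x ℕ.+ y ℕ.+ s ≡ x ℕ.+ s ℕ.+ y
      xyz x y = solve 3 (λ x y s → x :+ y :+ s := x :+ s :+ y) refl x y s

    period′ : ∀ i j → π′ (m ℕ.+ i) j ≡ π′ i (j + t′)
    period′ i j = begin
      π C (m ℕ.+ i ℕ.+ s) (a * j + c (m ℕ.+ i))    ≡⟨ cong (λ k → π C k (a * j + c (m ℕ.+ i))) (ℕₚ.+-assoc m i s) ⟩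
      π C (m ℕ.+ (i ℕ.+ s)) (a * j + c (m ℕ.+ i))  ≡⟨ period C (i ℕ.+ s) _ ⟩
      π C (i ℕ.+ s) (a * j + c (m ℕ.+ i) + t)      ≡⟨ cong (π C (i ℕ.+ s)) values ⟩
      π C (i ℕ.+ s) (a * (j + t′) + c i)           ∎
      where
      values : a * j + c (m ℕ.+ i) + t ≡ a * (j + t′) + c i
      values = begin
        a * j + c (m ℕ.+ i) + t     ≡⟨ +-assoc (a * j) _ t ⟩
        a * j + (c (m ℕ.+ i) + t)   ≡⟨ cong (a * j +_) (c-period i) ⟩
        a * j + (a * t′ + c i)      ≡⟨ +-assoc (a * j) (a * t′) (c i) ⟨
        a * j + a * t′ + c i        ≡⟨ cong (_+ c i) (distribˡ a j t′) ⟨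
        a * (j + t′) + c i          ∎

    out′ : ∀ i j {v} → E (π′ i j) v ⇔ (v ≡ π′ (suc i) j ⊎ v ≡ π′ (suc i) (j + r′ ^ i))
    out′ i j {v} with shifts i
    ... | inj₁ (c-eq , r-eq) =
      subst₂ (λ x y → E (π′ i j) v ⇔ (v ≡ π C (suc i ℕ.+ s) x ⊎ v ≡ π C (suc i ℕ.+ s) y))
        (cong (a * j +_) (sym c-eq)) second (out C (i ℕ.+ s) (a * j + c i))
      where
      second : a * j + c i + r ^ (i ℕ.+ s) ≡ a * (j + r′ ^ i) + c (suc i)
      second = begin
        a * j + c i + r ^ (i ℕ.+ s)     ≡⟨ cong₂ (λ x y → a * j + x + y) c-eq r-eq ⟨
        a * j + c (suc i) + a * r′ ^ i  ≡⟨ xy∙z≈xz∙y (a * j) _ _ ⟩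
        a * j + a * r′ ^ i + c (suc i)  ≡⟨ cong (_+ c (suc i)) (distribˡ a j (r′ ^ i)) ⟨
        a * (j + r′ ^ i) + c (suc i)    ∎
    ... | inj₂ (c-eq , r-eq) = swap⇔ ⇔-∘
      subst₂ (λ x y → E (π′ i j) v ⇔ (v ≡ π C (suc i ℕ.+ s) x ⊎ v ≡ π C (suc i ℕ.+ s) y))
        first second (out C (i ℕ.+ s) (a * j + c i))
      where
      swap⇔ : ∀ {A B : Set} → (A ⊎ B) ⇔ (B ⊎ A)
      swap⇔ = mk⇔ Sum.swap Sum.swap

      first : a * j + c i ≡ a * (j + r′ ^ i) + c (suc i)
      first = begin
        a * j + c i                                     ≡⟨ +-identityʳ _ ⟨
        a * j + c i + 0#                                ≡⟨ cong (a * j + c i +_) r-eq ⟨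
        (a * j + c i) + (a * r′ ^ i + r ^ (i ℕ.+ s))    ≡⟨ interchange (a * j) (c i) _ _ ⟩
        (a * j + a * r′ ^ i) + (c i + r ^ (i ℕ.+ s))    ≡⟨ cong₂ _+_ (distribˡ a j (r′ ^ i)) c-eq ⟨
        a * (j + r′ ^ i) + c (suc i)                    ∎

      second : a * j + c i + r ^ (i ℕ.+ s) ≡ a * j + c (suc i)
      second = trans (+-assoc (a * j) (c i) _) (cong (a * j +_) (sym c-eq))

  -- Negating superscripts exchanges the out-neighbours in every layer, so layer `i` is displaced by
  -- all powers below `i`. Over one turn `t` must become `- t`, which is the relation between
  -- `powerSum m r` and `t`.
  reflect : powerSum m r + (t + t) ≡ 0# → r ^ m ≡ 1# → Coordinates E m r t → Coordinates E m r t
  reflect Σr+2t≡0 r^m≡1 C = recoordinate C 0 -1-unit (λ i → powerSum i r) shifts c-period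
    where
    shifts : Shifts 0 (- 1#) r (λ i → powerSum i r)
    shifts i = inj₂
      ( trans (Σ<-suc (r ^_) i) (cong (λ k → powerSum i r + r ^ k) (sym (ℕₚ.+-identityʳ i)))
      , trans (cong₂ (λ x k → x + r ^ k) (-1*x≈-x (r ^ i)) (ℕₚ.+-identityʳ i)) (-‿inverseˡ (r ^ i)))

    c-period : ∀ i → powerSum (m ℕ.+ i) r + t ≡ - 1# * t + powerSum i r
    c-period i = begin
      powerSum (m ℕ.+ i) r + t           ≡⟨ cong (_+ t) (powerSum-period {m = m} r^m≡1 i) ⟩
      powerSum m r + powerSum i r + t    ≡⟨ xy∙z≈xz∙y (powerSum m r) _ t ⟩
      powerSum m r + t + powerSum i r    ≡⟨ cong (_+ powerSum i r) (+-inverseˡ-unique (powerSum m r + t) t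
                                              (trans (+-assoc (powerSum m r) t t) Σr+2t≡0)) ⟩
      - t + powerSum i r                 ≡⟨ cong (_+ powerSum i r) (-1*x≈-x t) ⟨
      - 1# * t + powerSum i r            ∎

  -- Out-neighbours are exchanged in the odd layers only. Evenness of `m` makes the parity of a
  -- layer well defined around the turn.
  twist : 2 ∣ m → r ^ m ≡ 1# → Coordinates E m r t → Coordinates E m (- r) (t + oddPowerSum m r)
  twist 2∣m r^m≡1 C = recoordinate C 0 (1# , *-identityˡ 1# , *-identityˡ 1#) (λ i → oddPowerSum i r) shifts c-period
    where
    shifts : Shifts 0 1# (- r) (λ i → oddPowerSum i r)
    shifts i rewrite ℕₚ.+-identityʳ i | *-identityˡ ((- r) ^ i) = oddPowerSum-step r i

    c-period : ∀ i → oddPowerSum (m ℕ.+ i) r + t ≡ 1# * (t + oddPowerSum m r) + oddPowerSum i r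
    c-period i = begin
      oddPowerSum (m ℕ.+ i) r + t                   ≡⟨ cong (_+ t) (oddPowerSum-period r^m≡1 2∣m i) ⟩
      oddPowerSum m r + oddPowerSum i r + t         ≡⟨ +-comm _ t ⟩
      t + (oddPowerSum m r + oddPowerSum i r)       ≡⟨ +-assoc t _ _ ⟨
      t + oddPowerSum m r + oddPowerSum i r         ≡⟨ cong (_+ oddPowerSum i r) (*-identityˡ _) ⟨
      1# * (t + oddPowerSum m r) + oddPowerSum i r  ∎

  -- Starting at layer `s` multiplies every step by `r ^ s`, so superscripts are rescaled by it; the
  -- period survives because `r` fixes `t`.
  translate : Unit r → r * t ≡ t → Coordinates E m r t → ℕ → ℤ/ n → Coordinates E m r t
  translate r-unit rt≡t C s x = recoordinate C s (unit-^ r-unit s) (λ _ → x)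
    (λ i → inj₁ (refl , trans (sym (^-homo-* r s i)) (cong (r ^_) (ℕₚ.+-comm s i))))
    (λ _ → trans (+-comm x t) (cong (_+ x) (sym (fixed s))))
    where
    fixed : ∀ k → r ^ k * t ≡ t
    fixed zero    = *-identityˡ t
    fixed (suc k) = trans (*-assoc r (r ^ k) t) (trans (cong (r *_) (fixed k)) rt≡t)

  -- Reading the layers backwards, πᵒᵖ i j should be π (- i) (- q * j). Layer - i is
  -- represented by (m - 1) * i, which the period compensates with the summand - i * t.
  opposite-coordinates : ∀ {q} → q * r ≡ 1# → r ^ m ≡ 1# → r * t ≡ t →
    Coordinates E m r t → Coordinates (flip E) m q t
  opposite-coordinates {q} qr≡1 r^m≡1 rt≡t C = record
    { π          = πᵒᵖ
    ; surjective = surjectiveᵒᵖ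
    ; injective  = λ i eq → unit-cancelˡ b-unit (+-cancelʳ (i · u) _ _ (injective C (m₁ ℕ.* i) eq))
    ; layer      = layerᵒᵖ
    ; period     = periodᵒᵖ
    ; out        = outᵒᵖ
    }
    where
    m₁ = pred m
    -- The first backward step goes from layer 0 to layer -1 and may lower the superscript by
    -- `r ^ (m - 1)`, that is by `q`. Rescaling by `- q` turns this into the required step `q ^ 0`.
    b = - q
    u = - t

    πᵒᵖ : ℕ → ℤ/ n → V
    πᵒᵖ i j = π C (m₁ ℕ.* i) (b * j + i · u)

    b[-r]≡1 : b * - r ≡ 1#
    b[-r]≡1 = begin
      - q * - r    ≡⟨ -‿distribˡ-* q (- r) ⟨
      - (q * - r)  ≡⟨ cong -_ (*-comm q (- r)) ⟩
      - (- r * q)  ≡⟨ cong -_ (-‿distribˡ-* r q) ⟨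
      - - (r * q)  ≡⟨ -‿involutive _ ⟩
      r * q        ≡⟨ *-comm r q ⟩
      q * r        ≡⟨ qr≡1 ⟩
      1#           ∎

    b-unit : Unit b
    b-unit = - r , trans (*-comm (- r) b) b[-r]≡1 , b[-r]≡1

    bt≡u : b * t ≡ u
    bt≡u = begin
      - q * t        ≡⟨ -‿distribˡ-* q t ⟨
      - (q * t)      ≡⟨ cong (λ x → - (q * x)) rt≡t ⟨
      - (q * (r * t)) ≡⟨ cong -_ (*-assoc q r t) ⟨
      - (q * r * t)  ≡⟨ cong (λ x → - (x * t)) qr≡1 ⟩
      - (1# * t)     ≡⟨ cong -_ (*-identityˡ t) ⟩
      - t            ∎

    sucm₁ : suc m₁ ≡ m
    sucm₁ = ℕₚ.suc-pred m

    surjectiveᵒᵖ : ∀ v → ∃₂ λ i j → πᵒᵖ i j ≡ v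
    surjectiveᵒᵖ v with surjective C v
    -- The square of `m - 1` is congruent to 1 modulo `m`, so layer `k` is backward layer `m₁ * k`.
    ... | k , x , refl with relayer C {m₁ ℕ.* (m₁ ℕ.* k)} {k} k (m₁ ℕ.* k) layers x
      where
      layers : m₁ ℕ.* (m₁ ℕ.* k) ℕ.+ k ℕ.* m ≡ k ℕ.+ m₁ ℕ.* k ℕ.* m
      layers = subst (λ l → m₁ ℕ.* (m₁ ℕ.* k) ℕ.+ k ℕ.* l ≡ k ℕ.+ m₁ ℕ.* k ℕ.* l) sucm₁
        (solve 2 (λ m k → m :* (m :* k) :+ k :* (con 1 :+ m) := k :+ m :* k :* (con 1 :+ m)) refl m₁ k)
        where open +-*-Solver
    ... | y , eq = i , - r * (y + - (i · u)) , trans (cong (π C (m₁ ℕ.* i)) solves) eq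
      where
      i = m₁ ℕ.* k

      solves : b * (- r * (y + - (i · u))) + i · u ≡ y
      solves = begin
        b * (- r * (y + - (i · u))) + i · u  ≡⟨ cong (_+ i · u) (*-assoc b (- r) _) ⟨
        b * - r * (y + - (i · u)) + i · u    ≡⟨ cong (λ z → z * (y + - (i · u)) + i · u) b[-r]≡1 ⟩
        1# * (y + - (i · u)) + i · u         ≡⟨ cong (_+ i · u) (*-identityˡ _) ⟩
        (y + - (i · u)) + i · u              ≡⟨ x-y+y y (i · u) ⟩
        y                                    ∎

    layerᵒᵖ : ∀ {i i′ j j′} → πᵒᵖ i j ≡ πᵒᵖ i′ j′ → ∃₂ λ p q → i ℕ.+ p ℕ.* m ≡ i′ ℕ.+ q ℕ.* m
    layerᵒᵖ {i} {i′} eq with layer C eq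
    -- Adding `i + i′` to both sides of `eq′` completes `m₁ * i` and `m₁ * i′` to multiples of `m`.
    ... | p , q , eq′ = i′ ℕ.+ q , i ℕ.+ p , (begin
      i ℕ.+ (i′ ℕ.+ q) ℕ.* m
        ≡⟨ cong (λ l → i ℕ.+ (i′ ℕ.+ q) ℕ.* l) sucm₁ ⟨
      i ℕ.+ (i′ ℕ.+ q) ℕ.* suc m₁
        ≡⟨ solve 4 (λ i i′ q m → i :+ (i′ :+ q) :* (con 1 :+ m) := i′ :+ i :+ (m :* i′ :+ q :* (con 1 :+ m))) refl i i′ q m₁ ⟩
      i′ ℕ.+ i ℕ.+ (m₁ ℕ.* i′ ℕ.+ q ℕ.* suc m₁)
        ≡⟨ cong (λ l → i′ ℕ.+ i ℕ.+ (m₁ ℕ.* i′ ℕ.+ q ℕ.* l)) sucm₁ ⟩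
      i′ ℕ.+ i ℕ.+ (m₁ ℕ.* i′ ℕ.+ q ℕ.* m)
        ≡⟨ cong (i′ ℕ.+ i ℕ.+_) eq′ ⟨
      i′ ℕ.+ i ℕ.+ (m₁ ℕ.* i ℕ.+ p ℕ.* m)
        ≡⟨ cong (λ l → i′ ℕ.+ i ℕ.+ (m₁ ℕ.* i ℕ.+ p ℕ.* l)) sucm₁ ⟨
      i′ ℕ.+ i ℕ.+ (m₁ ℕ.* i ℕ.+ p ℕ.* suc m₁)
        ≡⟨ solve 4 (λ i i′ p m → i′ :+ (i :+ p) :* (con 1 :+ m) := i′ :+ i :+ (m :* i :+ p :* (con 1 :+ m))) refl i i′ p m₁ ⟨
      i′ ℕ.+ (i ℕ.+ p) ℕ.* suc m₁
        ≡⟨ cong (λ l → i′ ℕ.+ (i ℕ.+ p) ℕ.* l) sucm₁ ⟩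
      i′ ℕ.+ (i ℕ.+ p) ℕ.* m ∎)
      where open +-*-Solver

    periodᵒᵖ : ∀ i j → πᵒᵖ (m ℕ.+ i) j ≡ πᵒᵖ i (j + t)
    periodᵒᵖ i j = begin
      π C (m₁ ℕ.* (m ℕ.+ i)) (b * j + (m ℕ.+ i) · u)       ≡⟨ cong (λ k → π C k (b * j + (m ℕ.+ i) · u)) layers ⟩
      π C (m₁ ℕ.* i ℕ.+ m₁ ℕ.* m) (b * j + (m ℕ.+ i) · u)  ≡⟨ period* C m₁ (m₁ ℕ.* i) _ ⟩
      π C (m₁ ℕ.* i) (b * j + (m ℕ.+ i) · u + m₁ · t)      ≡⟨ cong (π C (m₁ ℕ.* i)) values ⟩
      π C (m₁ ℕ.* i) (b * (j + t) + i · u)                 ∎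
      where
      layers : m₁ ℕ.* (m ℕ.+ i) ≡ m₁ ℕ.* i ℕ.+ m₁ ℕ.* m
      layers = trans (ℕₚ.*-distribˡ-+ m₁ m i) (ℕₚ.+-comm (m₁ ℕ.* m) _)

      -- Going back `m` layers is represented by `m - 1` forward turns, which add `m₁ · t`; the
      -- correction contributes `m · u`. One `- t` remains.
      cancels : m · u + m₁ · t ≡ u
      cancels = begin
        m · u + m₁ · t          ≡⟨ cong (λ k → k · u + m₁ · t) sucm₁ ⟨
        u + m₁ · u + m₁ · t     ≡⟨ +-assoc u _ _ ⟩
        u + (m₁ · u + m₁ · t)   ≡⟨ cong (u +_) (·-distrib-+ u t m₁) ⟨
        u + m₁ · (u + t)        ≡⟨ cong (λ x → u + m₁ · x) (-‿inverseˡ t) ⟩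
        u + m₁ · 0#             ≡⟨ +-absorb u (·-zero m₁) ⟩
        u                       ∎
        where
        ·-zero : ∀ k → k · 0# {n} ≡ 0#
        ·-zero zero    = refl
        ·-zero (suc k) = trans (+-identityˡ _) (·-zero k)

      values : b * j + (m ℕ.+ i) · u + m₁ · t ≡ b * (j + t) + i · u
      values = begin
        b * j + (m ℕ.+ i) · u + m₁ · t        ≡⟨ +-assoc (b * j) _ _ ⟩
        b * j + ((m ℕ.+ i) · u + m₁ · t)      ≡⟨ cong (λ x → b * j + (x + m₁ · t)) (×-homo-+ u m i) ⟩
        b * j + (m · u + i · u + m₁ · t)      ≡⟨ cong (b * j +_) (xy∙z≈xz∙y (m · u) (i · u) (m₁ · t)) ⟩
        b * j + (m · u + m₁ · t + i · u)      ≡⟨ cong (λ x → b * j + (x + i · u)) cancels ⟩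
        b * j + (u + i · u)                   ≡⟨ +-assoc (b * j) u _ ⟨
        b * j + u + i · u                     ≡⟨ cong (λ x → b * j + x + i · u) bt≡u ⟨
        b * j + b * t + i · u                 ≡⟨ cong (_+ i · u) (distribˡ b j t) ⟨
        b * (j + t) + i · u                   ∎

    outᵒᵖ : ∀ i j {v} → E v (πᵒᵖ i j) ⇔ (v ≡ πᵒᵖ (suc i) j ⊎ v ≡ πᵒᵖ (suc i) (j + q ^ i))
    outᵒᵖ i j {v} = subst (λ w → E v w ⇔ (v ≡ πᵒᵖ (suc i) j ⊎ v ≡ πᵒᵖ (suc i) (j + q ^ i)))
      (sym predecessor) (in⇔ C (m₁ ℕ.* suc i) power)
      where
      predecessor : πᵒᵖ i j ≡ π C (suc (m₁ ℕ.* suc i)) (b * j + suc i · u)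
      predecessor = sym (begin
        π C (suc (m₁ ℕ.* suc i)) (b * j + suc i · u)  ≡⟨ cong (λ k → π C k (b * j + suc i · u))
                                                           (trans (cong suc (ℕₚ.*-suc m₁ i)) (cong (ℕ._+ m₁ ℕ.* i) sucm₁)) ⟩
        π C (m ℕ.+ m₁ ℕ.* i) (b * j + suc i · u)      ≡⟨ period C _ _ ⟩
        π C (m₁ ℕ.* i) (b * j + suc i · u + t)        ≡⟨ cong (π C (m₁ ℕ.* i)) values ⟩
        π C (m₁ ℕ.* i) (b * j + i · u)                ∎)
        where
        values : b * j + (u + i · u) + t ≡ b * j + i · u
        values = begin
          b * j + (u + i · u) + t    ≡⟨ +-assoc (b * j) _ t ⟩
          b * j + (u + i · u + t)    ≡⟨ cong (b * j +_) (xy∙z≈xz∙y u (i · u) t) ⟩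
          b * j + (u + t + i · u)    ≡⟨ cong (λ x → b * j + (x + i · u)) (-‿inverseˡ t) ⟩
          b * j + (0# + i · u)       ≡⟨ cong (b * j +_) (+-identityˡ _) ⟩
          b * j + i · u              ∎

      bqⁱ : b * q ^ i + r ^ (m₁ ℕ.* suc i) ≡ 0#
      bqⁱ = begin
        - q * q ^ i + r ^ (m₁ ℕ.* suc i)   ≡⟨ cong₂ _+_ (sym (-‿distribˡ-* q (q ^ i))) (sym (^-assocʳ r m₁ (suc i))) ⟩
        - (q ^ suc i) + (r ^ m₁) ^ suc i   ≡⟨ cong (λ x → - (q ^ suc i) + x ^ suc i) r^m₁≡q ⟩
        - (q ^ suc i) + q ^ suc i          ≡⟨ -‿inverseˡ _ ⟩
        0#                                 ∎
        where
        r^m₁≡q : r ^ m₁ ≡ q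
        r^m₁≡q = trans (sym (inverse-^ r^m≡1 {q} qr≡1 {1} {m₁} sucm₁)) (*-identityʳ q)

      power : b * (j + q ^ i) + suc i · u + r ^ (m₁ ℕ.* suc i) ≡ b * j + suc i · u
      power = begin
        b * (j + q ^ i) + suc i · u + r ^ (m₁ ℕ.* suc i)
          ≡⟨ xy∙z≈xz∙y (b * (j + q ^ i)) _ _ ⟩
        b * (j + q ^ i) + r ^ (m₁ ℕ.* suc i) + suc i · u
          ≡⟨ cong (λ x → x + r ^ (m₁ ℕ.* suc i) + suc i · u) (distribˡ b j (q ^ i)) ⟩
        b * j + b * q ^ i + r ^ (m₁ ℕ.* suc i) + suc i · u
          ≡⟨ cong (_+ suc i · u) (trans (+-assoc (b * j) _ _) (+-absorb (b * j) bqⁱ)) ⟩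
        b * j + suc i · u ∎

-- Rigidity

module _ {n : ℕ} .{{_ : NonZero n}} {m : ℕ} {r t : ℤ/ n} (a : Admissible m n r t) where

  open Admissible a
  open ≡-Reasoning

  rt≡t : r * t ≡ t
  rt≡t = +-cancelʳ (- t) _ _ (begin
    r * t + - t           ≡⟨ cong₂ _+_ (*-comm r t) (sym (-1*x≈-x t)) ⟩
    t * r + - 1# * t      ≡⟨ cong (t * r +_) (*-comm (- 1#) t) ⟩
    t * r + t * - 1#      ≡⟨ distribˡ t r (- 1#) ⟨
    t * (r + - 1#)        ≡⟨ t[r-1]≡0 ⟩
    0#                    ≡⟨ -‿inverseʳ t ⟨
    t + - t               ∎)

  Based : ∀ {V} {E : Rel V 0ℓ} → V → V → Coordinates E m r t → Set
  Based u v C = π C 0 0# ≡ u × π C 1 0# ≡ v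

  -- After a translation the arc starts at the origin; if it ends at the wrong one of the two
  -- out-neighbours, a reflection corrects this.
  rebase : ∀ {V} {E : Rel V 0ℓ} → Coordinates E m r t → ∀ {u v} → E u v → Σ (Coordinates E m r t) (Based u v)

  rebase {E = E} C {u} {v} e with surjective C u
  ... | s , x , refl = arrange (Equivalence.to (out C₁ 0 0#) (subst (λ u → E u v) (sym C₁-base) e))
    where
    instance
      m≢0 : NonZero m
      m≢0 = ℕ.>-nonZero (ℕₚ.≤-trans (ℕ.s≤s ℕ.z≤n) 4≤m)

    C₁ C₂ : Coordinates E m r t
    C₁ = translate r-unit rt≡t C s x
    C₂ = reflect Σr+2t≡0 r^m≡1 C₁

    C₁-base : π C₁ 0 0# ≡ π C s x
    C₁-base = cong (π C s) (trans (cong (_+ x) (zeroʳ (r ^ s))) (+-identityˡ x))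

    C₂-value : ∀ y → - 1# * 0# + y ≡ y
    C₂-value y = trans (cong (_+ y) (zeroʳ (- 1#))) (+-identityˡ y)

    arrange : v ≡ π C₁ 1 0# ⊎ v ≡ π C₁ 1 (0# + 1#) → Σ (Coordinates E m r t) (Based (π C s x) v)
    arrange (inj₁ eq) = C₁ , C₁-base , sym eq
    arrange (inj₂ eq) = C₂
      , trans (cong (π C₁ 0) (C₂-value 0#)) C₁-base
      , trans (cong (π C₁ 1) (trans (C₂-value (1# + 0#)) (+-comm 1# 0#))) (sym eq)

module _ {V : Set} {E : Rel V 0ℓ}
         {m n : ℕ} .{{_ : NonZero n}} {r t : ℤ/ n} (C : Coordinates E m r t)
         {m′ n′ : ℕ} .{{_ : NonZero n′}} {r′ t′ : ℤ/ n′} (C′ : Coordinates E m′ r′ t′) where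

  -- The moduli `n` and `n′` are not yet known to be equal, so a natural number counts the steps
  -- along the alternating cycle in both systems at once.
  Agree : Set
  Agree = ∀ x → π C 0 (x · 1#) ≡ π C′ 0 (x · 1#) × π C 1 (x · 1#) ≡ π C′ 1 (x · 1#)

  open ≡-Reasoning

  -- Follow the alternating cycle through layers 0 and 1.
  agree : 1# {n} ≢ 0# → π C 0 0# ≡ π C′ 0 0# → π C 1 0# ≡ π C′ 1 0# → Agree
  agree 1≢0 eq₀ eq₁ zero = eq₀ , eq₁
  agree 1≢0 eq₀ eq₁ (suc x) with agree 1≢0 eq₀ eq₁ x
  ... | ih₀ , ih₁ = lower , upper
    where
    y  = x · 1# {n}
    y′ = x · 1# {n′}

    1+y≢y : 1# + y ≢ y
    1+y≢y eq = 1≢0 (+-cancelʳ y 1# 0# (trans eq (sym (+-identityˡ y))))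

    -- One neighbour of the current vertex on the cycle is already matched, so the new one must
    -- match the other; `1+y≢y` rules out turning back. The same reasoning then gives `lower`.
    upper : π C 1 (1# + y) ≡ π C′ 1 (1# + y′)
    upper with Equivalence.to (out C′ 0 y′)
                 (subst₂ E ih₀ (cong (π C 1) (+-comm y 1#)) (edge₁ C 0 y))
    ... | inj₁ eq = contradiction (injective C 1 (trans eq (sym ih₁))) 1+y≢y
    ... | inj₂ eq = trans eq (cong (π C′ 1) (+-comm y′ 1#))

    lower : π C 0 (1# + y) ≡ π C′ 0 (1# + y′)
    lower with Equivalence.to (in⇔ C′ 0 (+-comm y′ 1#)) (subst (E _) upper (edge₀ C 0 (1# + y)))
    ... | inj₁ eq = eq
    ... | inj₂ eq = contradiction (injective C 0 (trans eq (sym ih₀))) 1+y≢y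

  sameLayer : Agree → ∀ i → ∃ λ y → π C i 0# ≡ π C′ i y
  sameLayer agrees zero = 0# , proj₁ (agrees 0)
  sameLayer agrees (suc i) with sameLayer agrees i
  ... | y , eq = out-layer C′ (subst (λ u → E u _) eq (edge₀ C i 0#))

  n′∣n : Agree → n′ ∣ n
  n′∣n agrees = ·1≡0⇒∣ n (injective C′ 0 (begin
    π C′ 0 (n · 1#)  ≡⟨ proj₁ (agrees n) ⟨
    π C 0 (n · 1#)   ≡⟨ cong (π C 0) n·1≡0 ⟩
    π C 0 0#         ≡⟨ proj₁ (agrees 0) ⟩
    π C′ 0 0#        ∎))

  -- After `m` layers a walk is back in layer 0 of `C`, which consists of vertices of layer 0 of
  -- `C′`. By `sameLayer` it has also climbed `m` layers of `C′`.
  m′∣m : Agree → m′ ∣ m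
  m′∣m agrees with sameLayer agrees (m ℕ.+ 0)
  ... | y , eq with layer C′ {m ℕ.+ 0} {0} (begin
        π C′ (m ℕ.+ 0) y              ≡⟨ eq ⟨
        π C (m ℕ.+ 0) 0#              ≡⟨ period C 0 0# ⟩
        π C 0 (0# + t)                ≡⟨ cong (π C 0) (trans (+-identityˡ t) (sym (toℕ·1 t))) ⟩
        π C 0 (toℕ t · 1#)            ≡⟨ proj₁ (agrees (toℕ t)) ⟩
        π C′ 0 (toℕ t · 1#)           ∎)
  ... | a , b , eq′ = ∣m+n∣m⇒∣n {m′} {a ℕ.* m′} (subst (m′ ∣_) (trans (sym eq′)
                        (solve 2 (λ m k → m :+ con 0 :+ k := k :+ m) refl m (a ℕ.* m′))) (n∣m*n b)) (n∣m*n a)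
    where open +-*-Solver

module _ {V : Set} {E : Rel V 0ℓ} {m n : ℕ} .{{_ : NonZero n}} where

  Aligned : ∀ {r t r′ t′ : ℤ/ n} → Coordinates E m r t → Coordinates E m r′ t′ → ℕ → Set
  Aligned C C′ i = ∀ j → π C i j ≡ π C′ i j

  agree⇒aligned : ∀ {r t r′ t′ : ℤ/ n} (C : Coordinates E m r t) (C′ : Coordinates E m r′ t′) →
    Agree C C′ → Aligned C C′ 0 × Aligned C C′ 1
  agree⇒aligned C C′ agrees =
    (λ j → subst (λ j → π C 0 j ≡ π C′ 0 j) (toℕ·1 j) (proj₁ (agrees (toℕ j)))) ,
    (λ j → subst (λ j → π C 1 j ≡ π C′ 1 j) (toℕ·1 j) (proj₂ (agrees (toℕ j))))

  -- The vertices of layer i with superscripts k and k + r^i have a common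
  -- out-neighbour.
  commonOut : ∀ {r t r′ t′ : ℤ/ n} (C : Coordinates E m r t) (C′ : Coordinates E m r′ t′) → ∀ i →
    Double≢0 (r ^ i) → Aligned C C′ i → ∀ k →
    (r′ ^ i ≡ r ^ i × π C (suc i) (k + r ^ i) ≡ π C′ (suc i) (k + r ^ i)) ⊎ r ^ i + r′ ^ i ≡ 0#
  commonOut {r} {r′ = r′} C C′ i 2rⁱ≢0 aligned k
    with Equivalence.to (out C′ i k) (subst (λ u → E u _) (aligned k) (edge₁ C i k))
       | Equivalence.to (out C′ i (k + r ^ i)) (subst (λ u → E u _) (aligned (k + r ^ i)) (edge₀ C i (k + r ^ i)))
  ... | inj₁ p | inj₁ q = contradiction (+-absorb⁻¹ (injective C′ (suc i) (trans (sym p) q))) (double≢0⇒≢0 2rⁱ≢0)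
  ... | inj₁ p | inj₂ q = inj₂ (+-absorb⁻¹ (trans (injective C′ (suc i) (trans (sym p) q)) (+-assoc k (r ^ i) (r′ ^ i))))
  ... | inj₂ p | inj₁ q = inj₁ (+-cancelˡ k _ _ (injective C′ (suc i) (trans (sym p) q)) , q)
  ... | inj₂ p | inj₂ q = contradiction
      (+-absorb⁻¹ (+-cancelʳ (r′ ^ i) k (k + r ^ i) (injective C′ (suc i) (trans (sym p) q)))) (double≢0⇒≢0 2rⁱ≢0)

  -- With equal `r`, the second outcome of `commonOut` would make `r ^ i` its own negative. Every
  -- vertex of the next layer is such a common out-neighbour, so alignment climbs.
  aligned-everywhere : ∀ {r t t′ : ℤ/ n} (C : Coordinates E m r t) (C′ : Coordinates E m r t′) →
    (∀ i → Double≢0 (r ^ i)) → Aligned C C′ 0 → ∀ i → Aligned C C′ i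
  aligned-everywhere C C′ 2rⁱ≢0 aligned₀ zero = aligned₀
  aligned-everywhere {r} C C′ 2rⁱ≢0 aligned₀ (suc i) j
    with commonOut C C′ i (2rⁱ≢0 i) (aligned-everywhere C C′ 2rⁱ≢0 aligned₀ i) (j + - (r ^ i))
  ... | inj₁ (_ , eq) = subst (λ j → π C (suc i) j ≡ π C′ (suc i) j) (x-y+y j (r ^ i)) eq
  ... | inj₂ 2rⁱ≡0    = contradiction 2rⁱ≡0 (2rⁱ≢0 i)

  aligned⇒t≡t′ : ∀ {r t t′ : ℤ/ n} (C : Coordinates E m r t) (C′ : Coordinates E m r t′) →
    (∀ i → Double≢0 (r ^ i)) → Aligned C C′ 0 → t ≡ t′
  aligned⇒t≡t′ {t = t} {t′} C C′ 2rⁱ≢0 aligned₀ = +-cancelˡ 0# t t′ (injective C′ 0 (begin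
    π C′ 0 (0# + t)      ≡⟨ aligned₀ (0# + t) ⟨
    π C 0 (0# + t)       ≡⟨ period C 0 0# ⟨
    π C (m ℕ.+ 0) 0#     ≡⟨ aligned-everywhere C C′ 2rⁱ≢0 aligned₀ (m ℕ.+ 0) 0# ⟩
    π C′ (m ℕ.+ 0) 0#    ≡⟨ period C′ 0 0# ⟩
    π C′ 0 (0# + t′)     ∎))
    where open ≡-Reasoning

-- Alignment of layer 1 determines `r` up to sign. The minus sign is absorbed by twisting `C`, which
-- leaves layer 0 unchanged because its correction is an empty sum; then only `t` remains to be
-- compared.
rigid-aligned : ∀ {V} {E : Rel V 0ℓ} {m n : ℕ} .{{_ : NonZero m}} .{{_ : NonZero n}} {r t r′ t′ : ℤ/ n}
  (C : Coordinates E m r t) (C′ : Coordinates E m r′ t′) → 2 ∣ m → r ^ m ≡ 1# →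
  (∀ i → Double≢0 (r ^ i)) → (∀ i → Double≢0 (r′ ^ i)) → Aligned C C′ 0 → Aligned C C′ 1 →
  (r′ ≡ r × t′ ≡ t) ⊎ (r′ ≡ - r × t′ ≡ t + oddPowerSum m r)
rigid-aligned {r = r} {t} {r′} {t′} C C′ 2∣m r^m≡1 2rⁱ≢0 2r′ⁱ≢0 aligned₀ aligned₁
  with commonOut C C′ 1 (2rⁱ≢0 1) aligned₁ 0#
... | inj₁ (r′^1≡r^1 , _) with trans (sym (*-identityʳ r′)) (trans r′^1≡r^1 (*-identityʳ r))
...   | refl = inj₁ (refl , sym (aligned⇒t≡t′ C C′ 2rⁱ≢0 aligned₀))
rigid-aligned {r = r} {t} {r′} {t′} C C′ 2∣m r^m≡1 2rⁱ≢0 2r′ⁱ≢0 aligned₀ aligned₁ | inj₂ r+r′≡0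
  with +-inverseˡ-unique r′ r (trans (+-comm r′ r) (trans (sym (cong₂ _+_ (*-identityʳ r) (*-identityʳ r′))) r+r′≡0))
...   | refl = inj₂ (refl , sym (aligned⇒t≡t′ (twist 2∣m r^m≡1 C) C′ 2r′ⁱ≢0 twisted₀))
  where
  twisted₀ : Aligned (twist 2∣m r^m≡1 C) C′ 0
  twisted₀ j = trans (cong (π C 0) (trans (+-identityʳ _) (*-identityˡ j))) (aligned₀ j)

Rigid : (m n : ℕ) .{{_ : NonZero n}} (r t : ℤ/ n) (m′ n′ : ℕ) .{{_ : NonZero n′}} (r′ t′ : ℤ/ n′) → Set
Rigid m n r t m′ n′ r′ t′ =
  m′ ≡ m ×
  Σ (n′ ≡ n) λ n′≡n →
    (cast n′≡n r′ ≡ r   × cast n′≡n t′ ≡ t)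
  ⊎ (cast n′≡n r′ ≡ - r × cast n′≡n t′ ≡ t + oddPowerSum m r)

rigid : ∀ {V} {E : Rel V 0ℓ}
  {m n : ℕ} .{{n≢0 : NonZero n}} {r t : ℤ/ n} → Coordinates E m r t →
  2 ∣ m → 4 ≤ m → 4 ≤ n → Unit r → r ^ m ≡ 1# →
  {m′ n′ : ℕ} .{{_ : NonZero n′}} {r′ t′ : ℤ/ n′} → Coordinates E m′ r′ t′ → Admissible m′ n′ r′ t′ →
  Rigid m n r t m′ n′ r′ t′
rigid {m = m} {n} {{n≢0}} {r} {t} C 2∣m 4≤m 4≤n r-unit r^m≡1 C′₀ a′ with rebase a′ C′₀ (edge₀ C 0 0#)
... | C′ , base₀ , base₁ = conclude
        (∣-antisym (m′∣m C C′ agrees) (m′∣m C′ C agrees⁻¹))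
        (∣-antisym (n′∣n C C′ agrees) (n′∣n C′ C agrees⁻¹)) C′ (Admissible.r-unit a′) agrees
  where
  agrees : Agree C C′
  agrees = agree C C′ (double≢0⇒≢0 (unit⇒double≢0 4≤n (unit-^ r-unit 0))) (sym base₀) (sym base₁)

  agrees⁻¹ : Agree C′ C
  agrees⁻¹ x = sym (proj₁ (agrees x)) , sym (proj₂ (agrees x))

  -- Stated for variable `m′` and `n′`, so that matching the equalities puts both systems over the
  -- same ring.
  conclude : ∀ {m′ n′} .{{_ : NonZero n′}} {r′ t′ : ℤ/ n′} → m′ ≡ m → n′ ≡ n →
    (C′ : Coordinates _ m′ r′ t′) → Unit r′ → Agree C C′ → Rigid m n r t m′ n′ r′ t′
  conclude {r′ = r′} {t′} refl refl C′ r′-unit agrees = refl , refl ,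
    Sum.map (λ { (p , q) → trans (cast-is-id refl r′) p , trans (cast-is-id refl t′) q })
            (λ { (p , q) → trans (cast-is-id refl r′) p , trans (cast-is-id refl t′) q })
      (rigid-aligned {{ℕ.>-nonZero (ℕₚ.≤-trans (ℕ.s≤s ℕ.z≤n) 4≤m)}} {{n≢0}} C C′ 2∣m r^m≡1 (powers r-unit) (powers r′-unit)
        (proj₁ aligned) (proj₂ aligned))
    where
    aligned = agree⇒aligned {{n≢0}} C C′ agrees

    powers : ∀ {x} → Unit x → ∀ i → Double≢0 (x ^ i)
    powers x-unit i = unit⇒double≢0 4≤n (unit-^ x-unit i)

-- The coordinates of 𝒳ₑ

module _ {m n : ℕ} .{{_ : NonZero m}} .{{_ : NonZero n}} {r t : ℤ/ n} (r^m≡1 : r ^ m ≡ 1#) where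

  open ≡-Reasoning

  remainder-quotient-unique : ∀ (p p′ : Fin m) q q′ → toℕ p ℕ.+ q ℕ.* m ≡ toℕ p′ ℕ.+ q′ ℕ.* m → p ≡ p′ × q ≡ q′
  remainder-quotient-unique p p′ q q′ eq = p≡p′ , q≡q′
    where
    remainder : ∀ (p : Fin m) q → (toℕ p ℕ.+ q ℕ.* m) % m ≡ toℕ p
    remainder p q = trans ([m+kn]%n≡m%n (toℕ p) q m) (m<n⇒m%n≡m (toℕ<n p))

    p≡p′ : p ≡ p′
    p≡p′ = toℕ-injective (trans (sym (remainder p q)) (trans (cong (_% m) eq) (remainder p′ q′)))

    q≡q′ : q ≡ q′
    q≡q′ = ℕₚ.*-cancelʳ-≡ q q′ m (ℕₚ.+-cancelˡ-≡ (toℕ p) _ _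
      (trans eq (cong (λ p → toℕ p ℕ.+ q′ ℕ.* m) (sym p≡p′))))

  -- Climbing `i` layers from layer 0 completes `i / m` turns, each collecting one shift `t`.
  position : ℕ → ℤ/ n → Fin m × ℤ/ n
  position i j = i mod m , j + (i / m) · t

  decompose : ∀ i → i ≡ toℕ (i mod m) ℕ.+ i / m ℕ.* m
  decompose i = DivMod.property (i divMod m)

  position-at : ∀ {i} p q → i ≡ toℕ p ℕ.+ q ℕ.* m → ∀ j → position i j ≡ (p , j + q · t)
  position-at {i} p q eq j with remainder-quotient-unique (i mod m) p (i / m) q (trans (sym (decompose i)) eq)
  ... | p-eq , q-eq = cong₂ (λ p q → p , j + q · t) p-eq q-eq

  ^-mod : ∀ i → r ^ i ≡ r ^ toℕ (i mod m)
  ^-mod i = begin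
    r ^ i                                    ≡⟨ cong (r ^_) (decompose i) ⟩
    r ^ (toℕ (i mod m) ℕ.+ i / m ℕ.* m)      ≡⟨ ^-homo-* r (toℕ (i mod m)) _ ⟩
    r ^ toℕ (i mod m) * r ^ (i / m ℕ.* m)    ≡⟨ cong (λ k → r ^ toℕ (i mod m) * r ^ k) (ℕₚ.*-comm (i / m) m) ⟩
    r ^ toℕ (i mod m) * r ^ (m ℕ.* (i / m))  ≡⟨ cong (r ^ toℕ (i mod m) *_) (^-assocʳ r m (i / m)) ⟨
    r ^ toℕ (i mod m) * (r ^ m) ^ (i / m)    ≡⟨ cong (λ x → r ^ toℕ (i mod m) * x ^ (i / m)) r^m≡1 ⟩
    r ^ toℕ (i mod m) * 1# ^ (i / m)         ≡⟨ cong (r ^ toℕ (i mod m) *_) (1^ (i / m)) ⟩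
    r ^ toℕ (i mod m) * 1#                   ≡⟨ *-identityʳ _ ⟩
    r ^ toℕ (i mod m)                        ∎

  coordinates : Coordinates (Step {m} r t) m r t
  coordinates = record
    { π          = position
    ; surjective = λ { (p , x) → toℕ p , x ,
        trans (position-at p 0 (sym (ℕₚ.+-identityʳ (toℕ p))) x) (cong (p ,_) (+-identityʳ x)) }
    ; injective  = λ i eq → +-cancelʳ ((i / m) · t) _ _ (cong proj₂ eq)
    ; layer      = layer′
    ; period     = λ i j → trans
        (position-at (i mod m) (suc (i / m)) (suc-turn i) j)
        (cong (i mod m ,_) (sym (+-assoc j t _)))
    ; out        = out′
    }
    where
    layer′ : ∀ {i i′ j j′} → position i j ≡ position i′ j′ → ∃₂ λ a b → i ℕ.+ a ℕ.* m ≡ i′ ℕ.+ b ℕ.* m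
    layer′ {i} {i′} eq = i′ / m , i / m , (begin
      i ℕ.+ i′ / m ℕ.* m                               ≡⟨ cong (ℕ._+ i′ / m ℕ.* m) (decompose i) ⟩
      toℕ (i mod m) ℕ.+ i / m ℕ.* m ℕ.+ i′ / m ℕ.* m   ≡⟨ cong (λ p → toℕ p ℕ.+ i / m ℕ.* m ℕ.+ i′ / m ℕ.* m) (cong proj₁ eq) ⟩
      toℕ (i′ mod m) ℕ.+ i / m ℕ.* m ℕ.+ i′ / m ℕ.* m  ≡⟨ solve 3 (λ p x y → p :+ x :+ y := p :+ y :+ x) refl (toℕ (i′ mod m)) (i / m ℕ.* m) (i′ / m ℕ.* m) ⟩
      toℕ (i′ mod m) ℕ.+ i′ / m ℕ.* m ℕ.+ i / m ℕ.* m  ≡⟨ cong (ℕ._+ i / m ℕ.* m) (decompose i′) ⟨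
      i′ ℕ.+ i / m ℕ.* m                               ∎)
      where open +-*-Solver

    suc-turn : ∀ i → m ℕ.+ i ≡ toℕ (i mod m) ℕ.+ suc (i / m) ℕ.* m
    suc-turn i = trans (cong (m ℕ.+_) (decompose i))
      (solve 3 (λ m p k → m :+ (p :+ k) := p :+ (m :+ k)) refl m (toℕ (i mod m)) (i / m ℕ.* m))
      where open +-*-Solver

    out′ : ∀ i j {v} → Step r t (position i j) v ⇔ (v ≡ position (suc i) j ⊎ v ≡ position (suc i) (j + r ^ i))
    out′ i j {v} with suc (toℕ (i mod m)) ℕₚ.<? m
    ... | yes 1+p<m = subst₂ (λ x y → Step r t (p , j + q · t) v ⇔ (v ≡ x ⊎ v ≡ y))
          (sym (next-at j))
          (sym (trans (next-at (j + r ^ i)) (cong (p′ ,_) second)))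
          (mk⇔ into from)
      where
      p  = i mod m
      q  = i / m
      p′ = fromℕ< 1+p<m

      next-at : ∀ x → position (suc i) x ≡ (p′ , x + q · t)
      next-at = position-at p′ q (trans (cong suc (decompose i)) (cong (ℕ._+ q ℕ.* m) (sym (toℕ-fromℕ< 1+p<m))))

      second : j + r ^ i + q · t ≡ j + q · t + r ^ toℕ p
      second = trans (xy∙z≈xz∙y j (r ^ i) (q · t)) (cong (j + q · t +_) (^-mod i))

      into : Step r t (p , j + q · t) v → v ≡ (p′ , j + q · t) ⊎ v ≡ (p′ , j + q · t + r ^ toℕ p)
      into (next eq d) = Sum.map (cong₂ _,_ p-eq) (cong₂ _,_ p-eq) d
        where p-eq = toℕ-injective (trans eq (sym (toℕ-fromℕ< 1+p<m)))
      into (wrap last _ _) = contradiction last (ℕₚ.<⇒≢ 1+p<m)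

      from : v ≡ (p′ , j + q · t) ⊎ v ≡ (p′ , j + q · t + r ^ toℕ p) → Step r t (p , j + q · t) v
      from (inj₁ refl) = next (toℕ-fromℕ< 1+p<m) (inj₁ refl)
      from (inj₂ refl) = next (toℕ-fromℕ< 1+p<m) (inj₂ refl)
    -- Here `i` lies in the last layer, so `suc i` begins a new turn: the quotient grows by one, and
    -- the additional `t` is the shift in `wrap`.
    ... | no 1+p≮m = subst₂ (λ x y → Step r t (p , j + q · t) v ⇔ (v ≡ x ⊎ v ≡ y))
          (sym (trans (wrap-at j) (cong (p₀ ,_) first)))
          (sym (trans (wrap-at (j + r ^ i)) (cong (p₀ ,_) second)))
          (mk⇔ into from)
      where
      p  = i mod m
      q  = i / m
      p₀ = 0 mod m

      p₀≡0 : toℕ p₀ ≡ 0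
      p₀≡0 = trans (toℕ-fromℕ< _) (m*n%n≡0 0 m)

      1+p≡m : suc (toℕ p) ≡ m
      1+p≡m = ℕₚ.≤-antisym (toℕ<n p) (ℕₚ.≮⇒≥ 1+p≮m)

      wrap-at : ∀ x → position (suc i) x ≡ (p₀ , x + suc q · t)
      wrap-at = position-at p₀ (suc q) (trans (cong suc (decompose i))
        (trans (cong (ℕ._+ q ℕ.* m) 1+p≡m) (cong (ℕ._+ suc q ℕ.* m) (sym p₀≡0))))

      first : j + (t + q · t) ≡ j + q · t + t
      first = trans (cong (j +_) (+-comm t (q · t))) (sym (+-assoc j (q · t) t))

      second : j + r ^ i + (t + q · t) ≡ j + q · t + r ^ (m ∸ 1) + t
      second = begin
        j + r ^ i + (t + q · t)          ≡⟨ cong (j + r ^ i +_) (+-comm t (q · t)) ⟩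
        j + r ^ i + (q · t + t)          ≡⟨ +-assoc (j + r ^ i) (q · t) t ⟨
        j + r ^ i + q · t + t            ≡⟨ cong (_+ t) (xy∙z≈xz∙y j (r ^ i) (q · t)) ⟩
        j + q · t + r ^ i + t            ≡⟨ cong (λ x → j + q · t + x + t) (trans (^-mod i) (cong (λ k → r ^ (k ∸ 1)) 1+p≡m)) ⟩
        j + q · t + r ^ (m ∸ 1) + t      ∎

      into : Step r t (p , j + q · t) v → v ≡ (p₀ , j + q · t + t) ⊎ v ≡ (p₀ , j + q · t + r ^ (m ∸ 1) + t)
      into (next {i′ = p″} eq _) = contradiction (subst (ℕ._< m) eq (toℕ<n p″)) 1+p≮m
      into (wrap _ eq d) = Sum.map (cong₂ _,_ p-eq) (cong₂ _,_ p-eq) d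
        where p-eq = toℕ-injective (trans eq (sym p₀≡0))

      from : v ≡ (p₀ , j + q · t + t) ⊎ v ≡ (p₀ , j + q · t + r ^ (m ∸ 1) + t) → Step r t (p , j + q · t) v
      from (inj₁ refl) = wrap 1+p≡m p₀≡0 (inj₁ refl)
      from (inj₂ refl) = wrap 1+p≡m p₀≡0 (inj₂ refl)

-- Isomorphisms and orientations

open Graph using (Vertex)
open _≅_ using (to; from; adjacency; bijection)

to∘from : ∀ {X Y} (φ : X ≅ Y) → ∀ v → to φ (from φ v) ≡ v
to∘from φ = Inverse.strictlyInverseˡ (bijection φ)

from∘to : ∀ {X Y} (φ : X ≅ Y) → ∀ v → from φ (to φ v) ≡ v
from∘to φ = Inverse.strictlyInverseʳ (bijection φ)

≅-sym : ∀ {X Y} → X ≅ Y → Y ≅ X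
≅-sym {X} {Y} φ = record
  { bijection = ↔-sym (bijection φ)
  ; adjacency = λ u v → mk⇔
      (λ e → Equivalence.from (adjacency φ (from φ u) (from φ v))
               (subst₂ (Graph._~_ Y) (sym (to∘from φ u)) (sym (to∘from φ v)) e))
      (λ e → subst₂ (Graph._~_ Y) (to∘from φ u) (to∘from φ v)
               (Equivalence.to (adjacency φ (from φ u) (from φ v)) e))
  }

≅-trans : ∀ {X Y Z} → X ≅ Y → Y ≅ Z → X ≅ Z
≅-trans φ ψ = record
  { bijection = ↔-trans (bijection φ) (bijection ψ)
  ; adjacency = λ u v → adjacency ψ (to φ u) (to φ v) ⇔-∘ adjacency φ u v
  }

Orients : (X : Graph) → Rel (Vertex X) 0ℓ → Set
Orients X E = ∀ {u v} → Graph._~_ X u v ⇔ SymClosure E u v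

Homogeneous : (X : Graph) → Rel (Vertex X) 0ℓ → Set
Homogeneous X E = ∀ {u v x y} → E u v → E x y → Σ (Automorphism X) λ φ → to φ u ≡ x × to φ v ≡ y

flip-SymClosure : ∀ {V : Set} {E : Rel V 0ℓ} {u v} → SymClosure E u v → SymClosure (flip E) u v
flip-SymClosure (fwd e) = bwd e
flip-SymClosure (bwd e) = fwd e

flip-orients : ∀ {X E} → Orients X E → Orients X (flip E)
flip-orients X-E = mk⇔ flip-SymClosure flip-SymClosure ⇔-∘ X-E

flip-homogeneous : ∀ {X E} → Homogeneous X E → Homogeneous X (flip E)
flip-homogeneous hom e e′ with hom e e′
... | φ , eq , eq′ = φ , eq′ , eq

-- Between different graphs this yields the isomorphisms of the theorem; between two systems on one
-- digraph it yields automorphisms.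
same-coordinates⇒≅ : ∀ {X Y E F} → Orients X E → Orients Y F →
  ∀ {m n} .{{_ : NonZero n}} {r t : ℤ/ n} → Coordinates E m r t → Coordinates F m r t →
  X ≅ Y
same-coordinates⇒≅ {X} {Y} {E} {F} X-E Y-F C D = record
  { bijection = mk↔ₛ′ (relabel C D) (relabel D C) (relabel-inverse D C) (relabel-inverse C D)
  ; adjacency = λ u v → mk⇔
      (λ e → Equivalence.from Y-F (gmap (relabel C D) (relabel-E C D) (Equivalence.to X-E e)))
      (λ e → subst₂ (Graph._~_ X) (relabel-inverse C D u) (relabel-inverse C D v)
               (Equivalence.from X-E (gmap (relabel D C) (relabel-E D C) (Equivalence.to Y-F e))))
  }

-- Rebasing at either arc keeps the parameters, so relabelling one system by the other carries base
-- arc to base arc.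
coordinates⇒homogeneous : ∀ {X E} → Orients X E →
  ∀ {m n} .{{_ : NonZero n}} {r t : ℤ/ n} → Admissible m n r t → Coordinates E m r t → Homogeneous X E
coordinates⇒homogeneous {X} X-E a C {u} {v} {x} {y} e e′ with rebase a C e | rebase a C e′
... | D , refl , refl | D′ , eq₀ , eq₁ =
  same-coordinates⇒≅ X-E X-E D D′ , trans (relabel-π D D′ 0 0#) eq₀ , trans (relabel-π D D′ 1 0#) eq₁

-- An automorphism reversing some edge would, together with homogeneity, make all arcs equivalent.
no-reversal : ∀ {X E} → Orients X E → Homogeneous X E → ¬ ArcTransitive X →
  (φ : Automorphism X) → ∀ {u v} → E u v → ¬ E (to φ v) (to φ u)
no-reversal {X} {E} X-E hom ¬arc φ {u} {v} e reversed = ¬arc λ e₁ e₂ → connect (reach e₁) (reach e₂)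
  where
  Reaches : Rel (Vertex X) 0ℓ
  Reaches x y = Σ (Automorphism X) λ ψ → to ψ u ≡ x × to ψ v ≡ y

  reach : ∀ {x y} → Graph._~_ X x y → Reaches x y
  reach x~y with Equivalence.to X-E x~y
  ... | fwd e′ = hom e e′
  ... | bwd e′ with hom reversed e′
  ...   | ψ , eq , eq′ = ≅-trans φ ψ , eq′ , eq

  connect : ∀ {w x y z} → Reaches w x → Reaches y z → Σ (Automorphism X) λ ψ → to ψ w ≡ y × to ψ x ≡ z
  connect (ψ , refl , refl) (χ , refl , refl) =
    ≅-trans (≅-sym ψ) χ , cong (to χ) (from∘to ψ u) , cong (to χ) (from∘to ψ v)

module _ {X Y : Graph} (φ : X ≅ Y) {E F} (X-E : Orients X E) (Y-F : Orients Y F)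
         (X-hom : Homogeneous X E) (Y-hom : Homogeneous Y F) (¬arc : ¬ ArcTransitive X) where

  -- If one arc were preserved and another reversed, conjugating by `φ` an automorphism of `Y` that
  -- links their images would give an automorphism of `X` reversing an arc.
  orientation-preserved : ∀ {u v} → E u v → F (to φ u) (to φ v) → ∀ {x y} → E x y → F (to φ x) (to φ y)
  orientation-preserved {u} {v} e f {x} {y} e′
    with Equivalence.to Y-F (Equivalence.to (adjacency φ x y) (Equivalence.from X-E (fwd e′)))
  ... | fwd f′ = f′
  ... | bwd f′ with Y-hom f f′
  ...   | χ , eq , eq′ = contradiction
          (subst₂ E (sym (trans (cong (from φ) eq′) (from∘to φ x))) (sym (trans (cong (from φ) eq) (from∘to φ y))) e′)
          (no-reversal X-E X-hom ¬arc (≅-trans (≅-trans φ χ) (≅-sym φ)) e)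

  -- Coordinates are pulled back along `φ`. That `φ` also reflects arcs follows from preservation
  -- and the asymmetry of `F`.
  transport : ∀ {m n} .{{_ : NonZero n}} {r t : ℤ/ n} → 4 ≤ m → Coordinates F m r t →
    ∀ {u v} → E u v → F (to φ u) (to φ v) → Coordinates E m r t
  transport 4≤m D e f = record
    { π          = λ i j → from φ (π D i j)
    ; surjective = λ v → let i , j , eq = surjective D (to φ v) in i , j , trans (cong (from φ) eq) (from∘to φ v)
    ; injective  = λ i eq → injective D i (from-injective eq)
    ; layer      = λ eq → layer D (from-injective eq)
    ; period     = λ i j → cong (from φ) (period D i j)
    ; out        = λ i j → mk⇔
        (λ e → Sum.map from-≡ from-≡ (Equivalence.to (out D i j)
                 (subst (λ w → F w _) (to∘from φ _) (preserved e))))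
        (λ d → reflected (subst (λ w → F w _) (sym (to∘from φ _))
                 (Equivalence.from (out D i j) (Sum.map to-≡ to-≡ d))))
    }
    where
    from-injective : ∀ {x y} → from φ x ≡ from φ y → x ≡ y
    from-injective {x} {y} eq = trans (sym (to∘from φ x)) (trans (cong (to φ) eq) (to∘from φ y))

    from-≡ : ∀ {v w} → to φ v ≡ w → v ≡ from φ w
    from-≡ {v} refl = sym (from∘to φ v)

    to-≡ : ∀ {v w} → v ≡ from φ w → to φ v ≡ w
    to-≡ {w = w} refl = to∘from φ w

    preserved : ∀ {x y} → E x y → F (to φ x) (to φ y)
    preserved = orientation-preserved e f

    reflected : ∀ {x y} → F (to φ x) (to φ y) → E x y
    reflected {x} {y} f′ with Equivalence.to X-E (Equivalence.from (adjacency φ x y) (Equivalence.from Y-F (fwd f′)))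
    ... | fwd e′ = e′
    ... | bwd e′ = contradiction (preserved e′) (asymmetric D 4≤m f′)

-- The classification

module _ {m n : ℕ} .{{n≢0 : NonZero n}} {r t : ℤ/ n} (a : Admissible m n r t) where

  open Admissible a

  private
    instance
      m≢0 : NonZero m
      m≢0 = ℕ.>-nonZero (ℕₚ.≤-trans (ℕ.s≤s ℕ.z≤n) 4≤m)

  r⁻¹r≡1 : r⁻¹ * r ≡ 1#
  r⁻¹r≡1 = proj₁ (proj₂ r-unit)

  r⁻¹-unit : Unit r⁻¹
  r⁻¹-unit = r , proj₂ (proj₂ r-unit) , r⁻¹r≡1

  r⁻¹^m≡1 : r⁻¹ ^ m ≡ 1#
  r⁻¹^m≡1 = inverse-^ r^m≡1 {r⁻¹} r⁻¹r≡1 {m} {0} (ℕₚ.+-identityʳ m)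

  oddPowerSum-r⁻¹ : oddPowerSum m r⁻¹ ≡ oddPowerSum m r
  oddPowerSum-r⁻¹ = oddPowerSum-inverse r^m≡1 m-even {r⁻¹} r⁻¹r≡1

  forwards : Coordinates (Step {m} r t) m r t
  forwards = coordinates r^m≡1

  backwards : Coordinates (flip (Step {m} r t)) m r⁻¹ t
  backwards = opposite-coordinates {q = r⁻¹} r⁻¹r≡1 r^m≡1 (rt≡t a) forwards

  Step-orients : Orients (𝒳ₑ m n r t a) (Step r t)
  Step-orients = mk⇔ id id

  Step-homogeneous : Homogeneous (𝒳ₑ m n r t a) (Step r t)
  Step-homogeneous = coordinates⇒homogeneous Step-orients a forwards

-- Pulling the coordinates of `Y` back puts both systems on `E`, where `rigid` compares them.
-- Leaving `E` free lets the reversed digraph play its role.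
arc⇒rigid : ∀ {X Y} (φ : X ≅ Y) {E F} → Orients X E → Orients Y F →
  Homogeneous X E → Homogeneous Y F → ¬ ArcTransitive X →
  {m n : ℕ} .{{_ : NonZero n}} {r t : ℤ/ n} → Coordinates E m r t →
  2 ∣ m → 4 ≤ m → 4 ≤ n → Unit r → r ^ m ≡ 1# →
  {m′ n′ : ℕ} .{{_ : NonZero n′}} {r′ t′ : ℤ/ n′} → Coordinates F m′ r′ t′ → Admissible m′ n′ r′ t′ →
  ∀ {u v} → E u v → F (to φ u) (to φ v) → Rigid m n r t m′ n′ r′ t′
arc⇒rigid φ X-E Y-F X-hom Y-hom ¬arc C 2∣m 4≤m 4≤n r-unit r^m≡1 D a′ e f =
  rigid C 2∣m 4≤m 4≤n r-unit r^m≡1 (transport φ X-E Y-F X-hom Y-hom ¬arc (Admissible.4≤m a′) D e f) a′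

proposition9p1 : (m n : ℕ) .{{_ : NonZero n}} (r t : ℤ/ n) (a : Admissible m n r t) →
    HalfArcTransitive (𝒳ₑ m n r t a) →
    (m′ n′ : ℕ) .{{_ : NonZero n′}} (r′ t′ : ℤ/ n′) (a′ : Admissible m′ n′ r′ t′) →
    let open Admissible a using (r⁻¹) in
    (𝒳ₑ m n r t a ≅ 𝒳ₑ m′ n′ r′ t′ a′)
    ⇔
    (m′ ≡ m ×
    Σ (n′ ≡ n) λ n′≡n →
    (cast n′≡n r′ ≡ r       × cast n′≡n t′ ≡ t)
    ⊎ (cast n′≡n r′ ≡ - r     × cast n′≡n t′ ≡ t + oddPowerSum m r)
    ⊎ (cast n′≡n r′ ≡ r⁻¹     × cast n′≡n t′ ≡ t)
    ⊎ (cast n′≡n r′ ≡ - r⁻¹   × cast n′≡n t′ ≡ t + oddPowerSum m r))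
proposition9p1 m n {{n≢0}} r t a (_ , _ , ¬arc) m′ n′ r′ t′ a′ = mk⇔ parameters isomorphism
  where
  open Admissible a

  X  = 𝒳ₑ m n r t a
  X′ = 𝒳ₑ m′ n′ r′ t′ a′

  Parameters : Set
  Parameters = m′ ≡ m ×
    Σ (n′ ≡ n) λ n′≡n →
    (cast n′≡n r′ ≡ r       × cast n′≡n t′ ≡ t)
    ⊎ (cast n′≡n r′ ≡ - r     × cast n′≡n t′ ≡ t + oddPowerSum m r)
    ⊎ (cast n′≡n r′ ≡ r⁻¹     × cast n′≡n t′ ≡ t)
    ⊎ (cast n′≡n r′ ≡ - r⁻¹   × cast n′≡n t′ ≡ t + oddPowerSum m r)

  same : Rigid m n r t m′ n′ r′ t′ → Parameters
  same (m-eq , n-eq , inj₁ params) = m-eq , n-eq , inj₁ params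
  same (m-eq , n-eq , inj₂ params) = m-eq , n-eq , inj₂ (inj₁ params)

  inverse : Rigid m n r⁻¹ t m′ n′ r′ t′ → Parameters
  inverse (m-eq , n-eq , inj₁ params) = m-eq , n-eq , inj₂ (inj₂ (inj₁ params))
  inverse (m-eq , n-eq , inj₂ (r-eq , t-eq)) =
    m-eq , n-eq , inj₂ (inj₂ (inj₂ (r-eq , trans t-eq (cong (t +_) (oddPowerSum-r⁻¹ a)))))

  directed : ∀ (φ : X ≅ X′) {u v} → Step r t u v → SymClosure (Step r′ t′) (to φ u) (to φ v) → Parameters
  directed φ e (fwd f) = same (arc⇒rigid φ (Step-orients a) (Step-orients a′)
    (Step-homogeneous a) (Step-homogeneous a′) ¬arc
    (forwards a) m-even 4≤m 4≤n r-unit r^m≡1 (forwards a′) a′ e f)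
  -- An isomorphism that reverses an arc of `Step r t` preserves one of the flipped digraph, whose
  -- coordinates have `r⁻¹` in place of `r`.
  directed φ e (bwd f) = inverse (arc⇒rigid φ (flip-orients {X} (Step-orients a)) (Step-orients a′)
    (flip-homogeneous {X} (Step-homogeneous a)) (Step-homogeneous a′) ¬arc
    (backwards a) m-even 4≤m 4≤n (r⁻¹-unit a) (r⁻¹^m≡1 a) (forwards a′) a′ e f)

  parameters : X ≅ X′ → Parameters
  parameters φ = directed φ arc (Equivalence.to (adjacency φ _ _) (fwd arc))
    where arc = edge₀ (forwards a) 0 0#

  instance
    m≢0 : NonZero m
    m≢0 = ℕ.>-nonZero (ℕₚ.≤-trans (ℕ.s≤s ℕ.z≤n) 4≤m)

  sameParameters : m′ ≡ m → (n′≡n : n′ ≡ n) → ∀ {E} {x y : ℤ/ n} → Orients X E → Coordinates E m {{n≢0}} x y →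
    cast n′≡n r′ ≡ x → cast n′≡n t′ ≡ y → X ≅ X′
  sameParameters refl refl X-E C r-eq t-eq with trans (sym (cast-is-id refl r′)) r-eq | trans (sym (cast-is-id refl t′)) t-eq
  ... | refl | refl = same-coordinates⇒≅ X-E (Step-orients a′) {{n≢0}} C (forwards a′)

  -- In each case `X`, with its orientation or the reverse, carries coordinates with the parameters
  -- of `X′`, twisted when the sign is negative.
  isomorphism : Parameters → X ≅ X′
  isomorphism (m-eq , n-eq , inj₁ (r-eq , t-eq)) =
    sameParameters m-eq n-eq (Step-orients a) (forwards a) r-eq t-eq
  isomorphism (m-eq , n-eq , inj₂ (inj₁ (r-eq , t-eq))) =
    sameParameters m-eq n-eq (Step-orients a) (twist m-even r^m≡1 (forwards a)) r-eq t-eq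
  isomorphism (m-eq , n-eq , inj₂ (inj₂ (inj₁ (r-eq , t-eq)))) =
    sameParameters m-eq n-eq (flip-orients {X} (Step-orients a)) (backwards a) r-eq t-eq
  isomorphism (m-eq , n-eq , inj₂ (inj₂ (inj₂ (r-eq , t-eq)))) =
    sameParameters m-eq n-eq (flip-orients {X} (Step-orients a)) (twist m-even (r⁻¹^m≡1 a) (backwards a))
      r-eq (trans t-eq (cong (t +_) (sym (oddPowerSum-r⁻¹ a))))
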